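{- Let $(W,S)$ be a Coxeter system with $W$ finite and $S=\{s_i:i\in I\}$, let $w_\circ$ be the long element of $W$ (the unique element of maximum length), and let $i_N\cdots i_1$ be a reduced word for $w_\circ$ (so $w_\circ=s_{i_N}\cdots s_{i_1}$ with $N=\ell(w_\circ)$). Let $\mathscr L$ be a nonempty convex subset of $W$, and let $\tau_i\colon W\to W$ ($i\in I$) be the noninvertible Bender--Knuth toggles defined with respect to $\mathscr L$. Then $\tau_{i_N}\cdots\tau_{i_1}(W)=\mathscr L$.
   Context: Let $(W,S)$ be a Coxeter system with $S=\{s_i:i\in I\}$, $I$ a finite index set; $m(i,i')$ is the order of $s_is_{i'}$. The root space is $V=\mathbb R^I$ with standard basis the simple roots $\{\alpha_i:i\in I\}$ and symmetric bilinear form $B(\alpha_i,\alpha_{i'})=-\cos(\pi/m(i,i'))$ (and $-1$ if $m(i,i')=\infty$). $W$ acts on $V$ by $s_i\beta=\beta-2B(\beta,\alpha_i)\alpha_i$. The root system is $\Phi=\{w\alpha_i:w\in W,i\in I\}=\Phi^+\sqcup\Phi^-$, where $\Phi^+$ (positive roots) are those roots that are nonnegative combinations of simple roots and $\Phi^-=-\Phi^+$. For $\beta\in\Phi$ the half-space $H_\beta^+$ is $\{w\in W:w\beta\in\Phi^+\}$. A subset of $W$ is convex if it is an intersection of half-spaces (the empty intersection being $W$). For a nonempty convex set $\mathscr L\subseteq W$ let $\mathrm R(\mathscr L)=\{\beta\in\Phi:\mathscr L\subseteq H_\beta^+\}$. For $i\in I$, the noninvertible Bender--Knuth toggle $\tau_i\colon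 W\to W$ (with respect to $\mathscr L$) is defined by $\tau_i(u)=u$ if $u^{ -1}\alpha_i\in\mathrm R(\mathscr L)$ and $\tau_i(u)=s_iu$ otherwise. Juxtaposition of toggles denotes composition of functions, applied right to left. -}

module Defs where

open import Algebra.Apartness.Bundles using (HeytingField)
open import Algebra.Bundles using (CommutativeRing; Group)
open import Data.Bool.Base using (if_then_else_)
open import Data.Fin.Base using (Fin)
open import Data.Fin.Properties using (_≟_)
open import Data.List.Base
  using (List; []; _∷_; _++_; concat; foldr; length; map; replicate)
open import Data.Nat.Base as ℕ using (ℕ; zero; suc; NonZero)
open import Data.Product.Base using (_×_; _,_; ∃; proj₁; proj₂)
open import Data.Sum.Base using (_⊎_)
open import Function.Bundles using (Inverse)
open import Level using (Level; _⊔_) renaming (suc to lsuc)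
open import Relation.Binary.Construct.Closure.Equivalence using (EqClosure)
open import Relation.Binary.Core using (Rel)
open import Relation.Binary.PropositionalEquality using (_≡_) renaming (setoid to ≡-setoid)
open import Relation.Binary.Structures using (IsStrictPartialOrder)
open import Relation.Nullary using (¬_; does)
open import Relation.Unary using (Pred; _∈_; _∉_; _⊆_; _≐_; ⋂)

import Algebra.Definitions.RawMonoid as Multiple
import Algebra.Properties.CommutativeMonoid.Sum as Sum

-- The real numbers are given axiomatically, as an Archimedean,
-- Cauchy-complete ordered Heyting field.  These axioms determine ℝ up to
-- isomorphism, and (unlike a decidable total order) they are also satisfied
-- by the constructive Cauchy reals.

record Reals c ℓ₁ ℓ₂ ℓ₃ : Set (lsuc (c ⊔ ℓ₁ ⊔ ℓ₂ ⊔ ℓ₃)) where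
  field
    heytingField : HeytingField c ℓ₁ ℓ₂

  open HeytingField heytingField public

  commutativeRing : CommutativeRing c ℓ₁
  commutativeRing = record { isCommutativeRing = isCommutativeRing }

  open CommutativeRing commutativeRing public
    using (+-commutativeMonoid; +-rawMonoid)
  open Multiple +-rawMonoid public using () renaming (_×_ to _×ᴿ_)

  infix 4 _<_ _≤_

  field
    _<_                  : Rel Carrier ℓ₃
    isStrictPartialOrder : IsStrictPartialOrder _≈_ _<_
    #⇒<⊎>                : ∀ {x y} → x # y → x < y ⊎ y < x
    <⇒#                  : ∀ {x y} → x < y → x # y
    +-monoˡ-<            : ∀ z {x y} → x < y → x + z < y + z
    *-pos                : ∀ {x y} → 0# < x → 0# < y → 0# < x * y

  _≤_ : Rel Carrier ℓ₃
  x ≤ y = ¬ (y < x)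

  -- |f p − f q| ≤ 1/(k+1) for all p, q ≥ k.  In an Archimedean field every
  -- Cauchy sequence (with a modulus) has a subsequence of this kind.
  RegularCauchy : (ℕ → Carrier) → Set ℓ₃
  RegularCauchy f =
    ∀ k {p q} → k ℕ.≤ p → k ℕ.≤ q → suc k ×ᴿ (f p - f q) ≤ 1#

  _⟶_ : (ℕ → Carrier) → Carrier → Set ℓ₃
  f ⟶ x = ∀ k → suc k ×ᴿ (f k - x) ≤ 1# × suc k ×ᴿ (x - f k) ≤ 1#

  field
    archimedean : ∀ x → ∃ λ n → x < n ×ᴿ 1#
    complete    : ∀ f → RegularCauchy f → ∃ λ x → f ⟶ x

module Trigonometry {c ℓ₁ ℓ₂ ℓ₃} (R : Reals c ℓ₁ ℓ₂ ℓ₃) where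
  open Reals R

  Complex : Set c
  Complex = Carrier × Carrier

  re im : Complex → Carrier
  re = proj₁
  im = proj₂

  _^_ : Complex → ℕ → Complex
  z ^ zero  = 1# , 0#
  z ^ suc k = re z * re (z ^ k) - im z * im (z ^ k)
            , re z * im (z ^ k) + im z * re (z ^ k)

  -- x = cos(π/m), for m ≥ 1.  The point z = x + y·i is e^{iπ/m}: it lies on
  -- the unit circle, z^m = −1, and z^k = e^{ikπ/m} is in the open upper
  -- half-plane for 0 < k < m (this excludes the other solutions of z^m = −1).
  IsCosπ/ : ℕ → Carrier → Set (c ⊔ ℓ₁ ⊔ ℓ₃)
  IsCosπ/ m x = ∃ λ y →
      (x * x + y * y ≈ 1#)
    × (re ((x , y) ^ m) ≈ - 1#)
    × (im ((x , y) ^ m) ≈ 0#)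
    × (∀ k → 0 ℕ.< k → k ℕ.< m → 0# < im ((x , y) ^ k))

  IsCosπ/-function : (ℕ → Carrier) → Set (c ⊔ ℓ₁ ⊔ ℓ₃)
  IsCosπ/-function cosπ/ = ∀ m → .{{NonZero m}} → IsCosπ/ m (cosπ/ m)

module _ {c ℓ} (G : Group c ℓ) where
  open Group G using (Carrier; _≈_; ε; rawMonoid; setoid)
  open Multiple rawMonoid using () renaming (_×_ to _times_)

  -- Infinite order is encoded as 0.
  HasOrder : Carrier → ℕ → Set ℓ
  HasOrder g zero    = ∀ k → 0 ℕ.< k → ¬ (k times g ≈ ε)
  HasOrder g (suc n) =
      (suc n times g ≈ ε)
    × (∀ k → 0 ℕ.< k → k ℕ.< suc n → ¬ (k times g ≈ ε))

  Finite : Set (c ⊔ ℓ)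
  Finite = ∃ λ k → Inverse setoid (≡-setoid (Fin k))

-- Since s i ∙ s i ≈ ε, the case i = j of the relators makes each generator
-- its own inverse, so words in S (without formal inverses) suffice.  For
-- m i j ≡ 0, i.e. m(i,j) = ∞, the relator is the empty word.
module Words {n} (m : Fin n → Fin n → ℕ) where

  relator : Fin n → Fin n → List (Fin n)
  relator i j = concat (replicate (m i j) (i ∷ j ∷ []))

  data DeleteRelator : Rel (List (Fin n)) Level.zero where
    delete : ∀ u v i j → DeleteRelator (u ++ relator i j ++ v) (u ++ v)

  _~_ : Rel (List (Fin n)) Level.zero
  _~_ = EqClosure DeleteRelator

-- (W , S) with S = {s i} a set of elements of order 2 generating W, m i j
-- the order of s i ∙ s j, and the relations (s i ∙ s j)^(m i j) = 1 (m i j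
-- finite) defining W.
record CoxeterSystem c ℓ : Set (lsuc (c ⊔ ℓ)) where
  field
    group : Group c ℓ
    rank  : ℕ

  open Group group public

  I : Set
  I = Fin rank

  field
    s : I → Carrier

  eval : List I → Carrier
  eval is = foldr _∙_ ε (map s is)

  field
    s-injective : ∀ {i j} → s i ≈ s j → i ≡ j
    s-order     : ∀ i → HasOrder group (s i) 2
    m           : I → I → ℕ
    m-order     : ∀ i j → HasOrder group (s i ∙ s j) (m i j)
    generates   : ∀ w → ∃ λ is → eval is ≈ w

  open Words m public

  field
    presented : ∀ is → eval is ≈ ε → is ~ []

  HasLength : Carrier → ℕ → Set ℓ
  HasLength w k =
      (∃ λ is → eval is ≈ w × length is ≡ k)
    × (∀ is → eval is ≈ w → k ℕ.≤ length is)

  IsReducedWordFor : List I → Carrier → Set ℓ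
  IsReducedWordFor is w = eval is ≈ w × HasLength w (length is)

  IsLongElement : Carrier → Set (c ⊔ ℓ)
  IsLongElement w₀ = ∃ λ N →
    HasLength w₀ N × (∀ w k → HasLength w k → k ℕ.≤ N)

module RootSystem
  {c ℓ₁ ℓ₂ ℓ₃ w ℓ}
  (R : Reals c ℓ₁ ℓ₂ ℓ₃) (cosπ/ : ℕ → Reals.Carrier R)
  (C : CoxeterSystem w ℓ)
  where

  open Reals R using (_+_; _*_; -_; _-_; 0#; 1#; _≤_)
    renaming (Carrier to ℝ; _≈_ to _≈ᴿ_)
  open Sum (Reals.+-commutativeMonoid R) using (sum)
  open CoxeterSystem C
    using (I; s; m; generates; _∙_; _⁻¹; _≈_) renaming (Carrier to W)

  V : Set c
  V = I → ℝ

  infix 4 _≋_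

  _≋_ : Rel V ℓ₁
  β ≋ γ = ∀ k → β k ≈ᴿ γ k

  α : I → V
  α i k = if does (i ≟ k) then 1# else 0#

  -cosπ/ : ℕ → ℝ
  -cosπ/ zero      = - 1#
  -cosπ/ m@(suc _) = - cosπ/ m

  B : V → V → ℝ
  B β γ = sum λ i → sum λ j → (β i * γ j) * -cosπ/ (m i j)

  reflect : I → V → V
  reflect i β k = β k - ((1# + 1#) * B β (α i)) * α i k

  -- W acts through an expression of w in the generators.  The result does
  -- not depend on the expression, because the reflections satisfy the
  -- defining relations of W.
  infixr 7 _·_

  _·_ : W → V → V
  w · β = foldr reflect β (proj₁ (generates w))

  Φ : Pred V (ℓ₁ ⊔ w)
  Φ β = ∃ λ w → ∃ λ i → β ≋ w · α i

  Φ⁺ : Pred V (ℓ₁ ⊔ ℓ₃ ⊔ w)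
  Φ⁺ β = β ∈ Φ × (∀ k → 0# ≤ β k)

  H⁺ : V → Pred W (ℓ₁ ⊔ ℓ₃ ⊔ w)
  H⁺ β w = w · β ∈ Φ⁺

  -- The level a only bounds the size of the family of half-spaces.
  Convex : ∀ a {p} → Pred W p → Set (lsuc a ⊔ c ⊔ ℓ₁ ⊔ ℓ₃ ⊔ w ⊔ p)
  Convex a L = ∃ λ (A : Set a) → ∃ λ (β : A → V) →
    (∀ x → β x ∈ Φ) × (L ≐ ⋂ A (λ x → H⁺ (β x)))

  module _ {p} (L : Pred W p) where

    Rts : Pred V (ℓ₁ ⊔ ℓ₃ ⊔ w ⊔ p)
    Rts β = β ∈ Φ × (L ⊆ H⁺ β)

    -- The two clauses determine τ i.  Stating them as a specification avoids
    -- assuming separately that membership in Rts is decidable.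
    IsToggle : I → (W → W) → Set (ℓ₁ ⊔ ℓ₃ ⊔ w ⊔ p ⊔ ℓ)
    IsToggle i τᵢ = ∀ u →
        (u ⁻¹ · α i ∈ Rts → τᵢ u ≈ u)
      × (u ⁻¹ · α i ∉ Rts → τᵢ u ≈ s i ∙ u)

  -- For is = i_N ∷ … ∷ i_1 ∷ [], the image τ_{i_N} ⋯ τ_{i_1}(W).
  ToggleImage : (I → W → W) → List I → Pred W (w ⊔ ℓ)
  ToggleImage τ is v = ∃ λ u → foldr τ u is ≈ v

{-# OPTIONS --safe #-}

-- Let R be the set of roots that are nonnegative on 𝓛.  If u ∈ 𝓛 but s_i u ∉ 𝓛,
-- then u⁻¹α_i ∈ R, so every τ_i restricts to an involution of 𝓛; hence 𝓛 is
-- contained in the image.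
--
-- Conversely, apply the toggles to u along a reduced word, and let v be the
-- product of the generators read so far.  The following property of the pair
-- (v , u) is preserved: no positive root δ with v⁻¹δ negative has −u⁻¹δ ∈ R.
-- Reading i, it has to be shown for a positive root δ with δ' = s_i δ and
-- v⁻¹δ' negative.  If δ' is negative, then δ = α_i and the definition of τ_i gives
-- the claim.  Otherwise, if τ_i moves u, the case of δ' applies.  If it does not,
-- then γ = u⁻¹α_i ∈ R; with t = 2B(δ,α_i), if t ≥ 0, then −u⁻¹δ' = −u⁻¹δ + tγ and
-- the case of δ' applies, while if t ≤ 0, then v⁻¹δ = v⁻¹δ' + t v⁻¹α_i is
-- negative (v⁻¹α_i being positive, as the word is reduced) and the case of δ
-- itself applies.  When v = w₀ every positive root qualifies as δ, so no root of
-- R is negative at u, which means u ∈ 𝓛.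

module Submission where

open import Defs

open import Algebra.Bundles using (CommutativeRing; Group)
open import Algebra.Solver.Ring.AlmostCommutativeRing
  using (fromCommutativeRing; _-Raw-AlmostCommutative⟶_)
open import Data.Bool.Base using (if_then_else_)
open import Data.Empty using (⊥; ⊥-elim)
open import Data.Fin.Base using (Fin; zero; suc)
open import Data.Integer.Base as ℤ using (ℤ; +_; -[1+_]; +-*-rawRing)
open import Data.List.Base
  using (List; []; _∷_; _++_; [_]; concat; foldr; initLast; length; replicate; reverse; _∷ʳ′_)
open import Data.Maybe.Base as Maybe using ()
open import Data.Nat.Base as ℕ using (ℕ; zero; suc; parity)
open import Data.Nat.Induction using (<-wellFounded)
open import Data.Parity.Base as ℙ using (0ℙ; 1ℙ)
open import Data.Product.Base using (_×_; _,_; ∃; proj₁; proj₂)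
open import Data.Sum.Base using (_⊎_; inj₁; inj₂; [_,_]′)
open import Function.Base using (_∘_; flip)
open import Function.Bundles using (Inverse)
open import Induction.WellFounded using (Acc; acc)
open import Level using (Level; _⊔_)
open import Relation.Binary.Definitions using (Decidable; tri<; tri≈; tri>)
open import Relation.Binary.PropositionalEquality as ≡ using (_≡_; _≢_)
open import Relation.Binary.Structures using (IsStrictPartialOrder)
open import Relation.Nullary using (¬_; Dec; yes; no; does; contradiction)
open import Relation.Nullary.Decidable using (dec⇒maybe)
open import Relation.Unary using (Pred; Satisfiable; _≐_; _∈_; _∉_; _⊆_)

import Algebra.Apartness.Properties.HeytingCommutativeRing as HeytingProperties
import Algebra.Definitions.RawMonoid as Multiple
import Algebra.Properties.AbelianGroup as AbelianGroupProperties
import Algebra.Properties.Group as GroupProperties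
import Algebra.Properties.Ring as RingProperties
import Algebra.Properties.Semiring.Mult.TCOptimised as Mult
import Algebra.Properties.Semiring.Sum as Sum
import Algebra.Solver.Ring as RingSolver
import Data.Fin.Properties as Fin
import Data.Integer.Properties as ℤ
import Data.List.Properties as List
import Data.Nat.Properties as ℕ
import Data.Parity.Properties as ℙ
import Relation.Binary.Construct.Closure.Equivalence as EqClosure
import Relation.Binary.Reasoning.Setoid as SetoidReasoning
import Relation.Nullary.Decidable as Dec

-- Ring identities with integer coefficients in an arbitrary commutative ring.

module IntegerCoefficientSolver {c ℓ} (R : CommutativeRing c ℓ) where
  open CommutativeRing R
  open Mult semiring renaming (_×_ to _×ᴿ_)
  open RingProperties ring
    using (-0#≈0#; -‿distribʳ-*; -‿involutive)
  open AbelianGroupProperties +-abelianGroup using (⁻¹-∙-comm)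
  open SetoidReasoning setoid

  fromℤ : ℤ → Carrier
  fromℤ (+ n)    = n ×ᴿ 1#
  fromℤ -[1+ n ] = - (suc n ×ᴿ 1#)

  fromℤ-⊖ : ∀ m n → fromℤ (m ℤ.⊖ n) ≈ m ×ᴿ 1# - n ×ᴿ 1#
  fromℤ-⊖ m zero = sym (trans (+-congˡ -0#≈0#) (+-identityʳ _))
  fromℤ-⊖ zero (suc n) = sym (+-identityˡ _)
  fromℤ-⊖ (suc m) (suc n) = begin
    fromℤ (suc m ℤ.⊖ suc n)           ≡⟨ ≡.cong fromℤ (ℤ.[1+m]⊖[1+n]≡m⊖n m n) ⟩
    fromℤ (m ℤ.⊖ n)                   ≈⟨ fromℤ-⊖ m n ⟩
    m ×ᴿ 1# - n ×ᴿ 1#                 ≈⟨ +-congʳ (+-identityʳ _) ⟨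
    m ×ᴿ 1# + 0# - n ×ᴿ 1#            ≈⟨ +-congʳ (+-congˡ (-‿inverseʳ 1#)) ⟨
    m ×ᴿ 1# + (1# - 1#) - n ×ᴿ 1#     ≈⟨ +-congʳ (+-assoc _ _ _) ⟨
    m ×ᴿ 1# + 1# - 1# - n ×ᴿ 1#       ≈⟨ +-assoc _ _ _ ⟩
    m ×ᴿ 1# + 1# + (- 1# - n ×ᴿ 1#)   ≈⟨ +-cong (+-comm _ _) (⁻¹-∙-comm _ _) ⟩
    1# + m ×ᴿ 1# - (1# + n ×ᴿ 1#)     ≈⟨ +-cong (1+× m 1#) (-‿cong (1+× n 1#)) ⟨
    suc m ×ᴿ 1# - suc n ×ᴿ 1#         ∎

  fromℤ-+ : ∀ i j → fromℤ (i ℤ.+ j) ≈ fromℤ i + fromℤ j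
  fromℤ-+ (+ m)    (+ n)    = ×-homo-+ 1# m n
  fromℤ-+ (+ m)    -[1+ n ] = fromℤ-⊖ m (suc n)
  fromℤ-+ -[1+ m ] (+ n)    = trans (fromℤ-⊖ n (suc m)) (+-comm _ _)
  fromℤ-+ -[1+ m ] -[1+ n ] = begin
    - (suc (suc (m ℕ.+ n)) ×ᴿ 1#)      ≡⟨ ≡.cong (λ k → - (k ×ᴿ 1#)) (≡.cong suc (ℕ.+-suc m n)) ⟨
    - ((suc m ℕ.+ suc n) ×ᴿ 1#)        ≈⟨ -‿cong (×-homo-+ 1# (suc m) (suc n)) ⟩
    - (suc m ×ᴿ 1# + suc n ×ᴿ 1#)      ≈⟨ ⁻¹-∙-comm _ _ ⟨
    - (suc m ×ᴿ 1#) - (suc n ×ᴿ 1#)    ∎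

  fromℤ-neg : ∀ i → fromℤ (ℤ.- i) ≈ - fromℤ i
  fromℤ-neg (+ zero)  = sym -0#≈0#
  fromℤ-neg (+ suc n) = refl
  fromℤ-neg -[1+ n ]  = sym (-‿involutive _)

  fromℤ-*-+ : ∀ i n → fromℤ (i ℤ.* + n) ≈ fromℤ i * fromℤ (+ n)
  fromℤ-*-+ (+ m) n = begin
    fromℤ (+ m ℤ.* + n)      ≡⟨ ≡.cong fromℤ (ℤ.pos-* m n) ⟨
    (m ℕ.* n) ×ᴿ 1#          ≈⟨ ×1-homo-* m n ⟩
    (m ×ᴿ 1#) * (n ×ᴿ 1#)    ∎
  fromℤ-*-+ -[1+ m ] n = begin
    fromℤ (-[1+ m ] ℤ.* + n)         ≡⟨ ≡.cong fromℤ (ℤ.neg-distribˡ-* (+ suc m) (+ n)) ⟨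
    fromℤ (ℤ.- (+ suc m ℤ.* + n))    ≈⟨ fromℤ-neg (+ suc m ℤ.* + n) ⟩
    - fromℤ (+ suc m ℤ.* + n)        ≈⟨ -‿cong (fromℤ-*-+ (+ suc m) n) ⟩
    - ((suc m ×ᴿ 1#) * (n ×ᴿ 1#))    ≈⟨ RingProperties.-‿distribˡ-* ring _ _ ⟩
    - (suc m ×ᴿ 1#) * (n ×ᴿ 1#)      ∎

  fromℤ-* : ∀ i j → fromℤ (i ℤ.* j) ≈ fromℤ i * fromℤ j
  fromℤ-* i (+ n)    = fromℤ-*-+ i n
  fromℤ-* i -[1+ n ] = begin
    fromℤ (i ℤ.* -[1+ n ])         ≡⟨ ≡.cong fromℤ (ℤ.neg-distribʳ-* i (+ suc n)) ⟨
    fromℤ (ℤ.- (i ℤ.* + suc n))    ≈⟨ fromℤ-neg (i ℤ.* + suc n) ⟩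
    - fromℤ (i ℤ.* + suc n)        ≈⟨ -‿cong (fromℤ-*-+ i (suc n)) ⟩
    - (fromℤ i * (suc n ×ᴿ 1#))    ≈⟨ -‿distribʳ-* _ _ ⟩
    fromℤ i * - (suc n ×ᴿ 1#)      ∎

  morphism : +-*-rawRing -Raw-AlmostCommutative⟶ fromCommutativeRing R
  morphism = record
    { ⟦_⟧    = fromℤ
    ; +-homo = fromℤ-+
    ; *-homo = fromℤ-*
    ; -‿homo = fromℤ-neg
    ; 0-homo = refl
    ; 1-homo = refl
    }

  -- Coefficients are compared in ℤ, where equality is decidable; in the ring itself it need not be.
  open RingSolver +-*-rawRing (fromCommutativeRing R) morphism
    (λ i j → Maybe.map (reflexive ∘ ≡.cong fromℤ) (dec⇒maybe (i ℤ.≟ j)))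
    public using (solve; con; _:+_; _:*_; _:-_; :-_; _:=_)

-- Constructive order arithmetic, with `≤` as the negation of the reversed `<`.

module OrderedField {c ℓ₁ ℓ₂ ℓ₃} (R : Reals c ℓ₁ ℓ₂ ℓ₃) where
  open Reals R
  open IsStrictPartialOrder isStrictPartialOrder
    using (<-respˡ-≈; <-respʳ-≈) renaming (irrefl to <-irrefl; trans to <-trans)
  open IntegerCoefficientSolver commutativeRing public
  open HeytingProperties heytingCommutativeRing using (1#0)

  ≤-respʳ-≈ : ∀ {x y} → x ≈ y → 0# ≤ x → 0# ≤ y
  ≤-respʳ-≈ x≈y 0≤x y<0 = 0≤x (<-respˡ-≈ (sym x≈y) y<0)

  <0⇒0<- : ∀ {x} → x < 0# → 0# < - x
  <0⇒0<- {x} x<0 =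
    <-respˡ-≈ (-‿inverseʳ x) (<-respʳ-≈ (+-identityˡ (- x)) (+-monoˡ-< (- x) x<0))

  0<-⇒<0 : ∀ {x} → 0# < - x → x < 0#
  0<-⇒<0 {x} 0<-x =
    <-respˡ-≈ (+-identityˡ x) (<-respʳ-≈ (-‿inverseˡ x) (+-monoˡ-< x 0<-x))

  0<⇒0≤ : ∀ {x} → 0# < x → 0# ≤ x
  0<⇒0≤ 0<x x<0 = <-irrefl refl (<-trans 0<x x<0)

  ≈0⇒0≤ : ∀ {x} → x ≈ 0# → 0# ≤ x
  ≈0⇒0≤ x≈0 = <-irrefl x≈0

  0<1 : 0# < 1#
  0<1 with #⇒<⊎> 1#0
  ... | inj₂ 0<1 = 0<1
  -- If 1 were negative, then -1 would be positive and so would 1 = (-1)(-1).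
  ... | inj₁ 1<0 = <-respʳ-≈ (solve 0 (:- con (+ 1) :* (:- con (+ 1)) := con (+ 1)) refl)
                     (*-pos (<0⇒0<- 1<0) (<0⇒0<- 1<0))

  0≉1 : ¬ (0# ≈ 1#)
  0≉1 0≈1 = <-irrefl 0≈1 0<1

  -- Tightness of apartness: this takes the place of trichotomy in the proofs by contradiction
  -- below.
  ≮∧≯⇒≈0 : ∀ {x} → ¬ (x < 0#) → ¬ (0# < x) → x ≈ 0#
  ≮∧≯⇒≈0 x≮0 x≯0 = proj₁ (tight _ _) ([ x≮0 , x≯0 ]′ ∘ #⇒<⊎>)

  0≤-antisym : ∀ {x} → 0# ≤ x → 0# ≤ - x → x ≈ 0#
  0≤-antisym 0≤x 0≤-x =
    ≮∧≯⇒≈0 0≤x λ 0<x → 0≤-x (0<-⇒<0 (<-respʳ-≈ (solve 1 (λ x → x := :- (:- x)) refl _) 0<x))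

  -- If x + y were negative, then x > 0 would give y < x + y < 0. Hence x is zero, and y itself
  -- would be negative.
  0≤-+ : ∀ {x y} → 0# ≤ x → 0# ≤ y → 0# ≤ x + y
  0≤-+ {x} {y} 0≤x 0≤y x+y<0 = 0≤y (<-respˡ-≈ x+y≈y x+y<0)
    where
    x≯0 : ¬ (0# < x)
    x≯0 0<x = 0≤y (<-trans (<-respˡ-≈ (+-identityˡ y) (+-monoˡ-< y 0<x)) x+y<0)
    x+y≈y : x + y ≈ y
    x+y≈y = trans (+-congʳ (≮∧≯⇒≈0 0≤x x≯0)) (+-identityˡ y)

  -- Suppose xy < 0. If x > 0, then y > 0 is impossible, so y and with it xy vanish. Hence x is not
  -- positive, so it is zero, and again xy vanishes.
  0≤-* : ∀ {x y} → 0# ≤ x → 0# ≤ y → 0# ≤ x * y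
  0≤-* {x} {y} 0≤x 0≤y xy<0 = ≈0⇒0≤ (trans (*-congʳ x≈0) (zeroˡ y)) xy<0
    where
    x≯0 : ¬ (0# < x)
    x≯0 0<x = ≈0⇒0≤ (trans (*-congˡ y≈0) (zeroʳ x)) xy<0
      where
      y≈0 : y ≈ 0#
      y≈0 = ≮∧≯⇒≈0 0≤y λ 0<y → 0<⇒0≤ (*-pos 0<x 0<y) xy<0
    x≈0 : x ≈ 0#
    x≈0 = ≮∧≯⇒≈0 0≤x x≯0

  0≤-cancelˡ-* : ∀ {x y} → 0# < x → 0# ≤ x * y → 0# ≤ y
  0≤-cancelˡ-* {x} {y} 0<x 0≤xy y<0 = 0≤xy (0<-⇒<0
    (<-respʳ-≈ (solve 2 (λ x y → x :* (:- y) := :- (x :* y)) refl x y)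
      (*-pos 0<x (<0⇒0<- y<0))))

  ≈0-cancelˡ-* : ∀ {x y} → 0# < x → x * y ≈ 0# → y ≈ 0#
  ≈0-cancelˡ-* {x} {y} 0<x xy≈0 = 0≤-antisym
    (0≤-cancelˡ-* 0<x (≈0⇒0≤ xy≈0))
    (0≤-cancelˡ-* 0<x (≈0⇒0≤ (trans (solve 2 (λ x y → x :* (:- y) := :- (x :* y)) refl x y)
      (trans (-‿cong xy≈0) (solve 0 (:- con (+ 0) := con (+ 0)) refl)))))

-- Chebyshev polynomials at cos(π/m).

module Chebyshev {c ℓ₁ ℓ₂ ℓ₃} (R : Reals c ℓ₁ ℓ₂ ℓ₃) where
  open Reals R
  open OrderedField R
  open Trigonometry R
  open SetoidReasoning (CommutativeRing.setoid commutativeRing)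

  -- U c k is the Chebyshev polynomial of the second kind of degree k − 1, so
  -- that U (cos θ) k = sin kθ / sin θ.
  U : Carrier → ℕ → Carrier
  U c 0             = 0#
  U c 1             = 1#
  U c (suc (suc k)) = (c + c) * U c (suc k) - U c k

  -- With d = 2c, the recurrence sends (u, v) to (v, dv - u) and preserves the form u² + v² - duv,
  -- whose initial value is 1.
  U-invariant : ∀ c k →
    U c k * U c k + U c (suc k) * U c (suc k) - (c + c) * (U c k * U c (suc k)) ≈ 1#
  U-invariant c zero =
    solve 1 (λ d → con (+ 0) :* con (+ 0) :+ con (+ 1) :* con (+ 1)
                     :- d :* (con (+ 0) :* con (+ 1)) := con (+ 1)) refl (c + c)
  U-invariant c (suc k) = trans
    (solve 3 (λ d u v →
        let w = d :* v :- u in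
        v :* v :+ w :* w :- d :* (v :* w) := u :* u :+ v :* v :- d :* (u :* v))
      refl (c + c) (U c k) (U c (suc k)))
    (U-invariant c k)

  -- This is the case m = ∞, where θ = 0 and the quotient of sines degenerates to the number k.
  U-1 : ∀ k → U 1# (suc k) ≈ U 1# k + 1#
  U-1 zero    = sym (+-identityˡ 1#)
  U-1 (suc k) = begin
    (1# + 1#) * U 1# (suc k) - U 1# k                 ≈⟨ +-congˡ (-‿cong u≈) ⟩
    (1# + 1#) * U 1# (suc k) - (U 1# (suc k) - 1#)
      ≈⟨ solve 1 (λ v → (con (+ 1) :+ con (+ 1)) :* v :- (v :- con (+ 1)) := v :+ con (+ 1)) refl _ ⟩
    U 1# (suc k) + 1#                                 ∎
    where
    u≈ : U 1# k ≈ U 1# (suc k) - 1#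
    u≈ = trans (solve 1 (λ u → u := u :+ con (+ 1) :- con (+ 1)) refl _) (+-congʳ (sym (U-1 k)))

  0≤U-1 : ∀ k → 0# ≤ U 1# k
  0≤U-1 zero    = ≈0⇒0≤ refl
  0≤U-1 (suc k) = ≤-respʳ-≈ (sym (U-1 k)) (0≤-+ (0≤U-1 k) (0<⇒0≤ 0<1))

  module _ {x y : Carrier} (x²+y²≈1 : x * x + y * y ≈ 1#) where

    -- De Moivre's formulas, proved together by induction. The circle equation removes y² from the
    -- real part.
    re-^ : ∀ k → re ((x , y) ^ k) ≈ U x (suc k) - x * U x k
    im-^ : ∀ k → im ((x , y) ^ k) ≈ y * U x k

    re-^ zero = solve 1 (λ x → con (+ 1) := con (+ 1) :- x :* con (+ 0)) refl x
    re-^ (suc k) = begin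
      x * re ((x , y) ^ k) - y * im ((x , y) ^ k)
        ≈⟨ +-cong (*-congˡ (re-^ k)) (-‿cong (*-congˡ (im-^ k))) ⟩
      x * (v - x * u) - y * (y * u)
        ≈⟨ solve 4 (λ x y u v →
             x :* (v :- x :* u) :- y :* (y :* u) := x :* v :- (x :* x :+ y :* y) :* u) refl x y u v ⟩
      x * v - (x * x + y * y) * u
        ≈⟨ +-congˡ (-‿cong (*-congʳ x²+y²≈1)) ⟩
      x * v - 1# * u
        ≈⟨ solve 3 (λ x u v →
             x :* v :- con (+ 1) :* u := ((x :+ x) :* v :- u) :- x :* v) refl x u v ⟩
      ((x + x) * v - u) - x * v  ∎
      where
      u = U x k
      v = U x (suc k)

    im-^ zero = sym (CommutativeRing.zeroʳ commutativeRing y)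
    im-^ (suc k) = begin
      x * im ((x , y) ^ k) + y * re ((x , y) ^ k)
        ≈⟨ +-cong (*-congˡ (im-^ k)) (*-congˡ (re-^ k)) ⟩
      x * (y * u) + y * (v - x * u)
        ≈⟨ solve 4 (λ x y u v → x :* (y :* u) :+ y :* (v :- x :* u) := y :* v) refl x y u v ⟩
      y * v  ∎
      where
      u = U x k
      v = U x (suc k)

  -- 0 stands for ∞, and cos(π/∞) = 1.
  cosine : (ℕ → Carrier) → ℕ → Carrier
  cosine cosπ/ zero      = 1#
  cosine cosπ/ m@(suc _) = cosπ/ m

  -- The upper bound is a Coxeter exponent, so its value `0` again means ∞.
  _≤∞_ : ℕ → ℕ → Set
  k ≤∞ m = m ≡ 0 ⊎ k ℕ.≤ m

  module _ {cosπ/ : ℕ → Carrier} (isCosπ/ : IsCosπ/-function cosπ/) where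

    cosπ/1≈-1 : cosπ/ 1 ≈ - 1#
    cosπ/1≈-1 with isCosπ/ 1
    ... | y , _ , re≈-1 , _ = trans
      (solve 2 (λ x y → x := x :* con (+ 1) :- y :* con (+ 0)) refl (cosπ/ 1) y) re≈-1

    module _ (k : ℕ) where
      private
        m : ℕ
        m = suc (suc k)
        y : Carrier
        y = proj₁ (isCosπ/ m)

      0<sin : 0# < y
      0<sin with isCosπ/ m
      ... | y , _ , _ , _ , 0<im = IsStrictPartialOrder.<-respʳ-≈ isStrictPartialOrder
        (solve 2 (λ x y → x :* con (+ 0) :+ y :* con (+ 1) := y) refl (cosπ/ m) y)
        (0<im 1 (ℕ.s≤s ℕ.z≤n) (ℕ.s≤s (ℕ.s≤s ℕ.z≤n)))

      -- The imaginary part of z^m is 0, and it is the product of this value with sin(π/m) > 0,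
      -- which can be cancelled.
      U-cosπ/≈0 : U (cosπ/ m) m ≈ 0#
      U-cosπ/≈0 with isCosπ/ m | 0<sin
      ... | y , circle , _ , im≈0 , _ | 0<y =
        ≈0-cancelˡ-* 0<y (trans (sym (im-^ circle m)) im≈0)

      0≤U-cosπ/ : ∀ {j} → j ℕ.≤ m → 0# ≤ U (cosπ/ m) j
      0≤U-cosπ/ {zero}  _ = ≈0⇒0≤ refl
      0≤U-cosπ/ {j@(suc _)} j≤m with ℕ.m≤n⇒m<n∨m≡n j≤m
      ... | inj₂ ≡.refl = ≈0⇒0≤ U-cosπ/≈0
      ... | inj₁ j<m with isCosπ/ m | 0<sin
      ...   | y , circle , _ , _ , 0<im | 0<y =
        0≤-cancelˡ-* 0<y (≤-respʳ-≈ (im-^ circle j) (0<⇒0≤ (0<im j (ℕ.s≤s ℕ.z≤n) j<m)))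

    -- The value m = 1 has to be excluded because `U` is 1 there; it does not occur for two distinct
    -- generators. For m = ∞ the index is `0`, where `U` is zero.
    U-cosine≈0 : ∀ m → m ≢ 1 → U (cosine cosπ/ m) m ≈ 0#
    U-cosine≈0 0             _   = refl
    U-cosine≈0 1             m≢1 = contradiction ≡.refl m≢1
    U-cosine≈0 (suc (suc k)) _   = U-cosπ/≈0 k

    0≤U-cosine : ∀ m → m ≢ 1 → ∀ {k} → k ≤∞ m → 0# ≤ U (cosine cosπ/ m) k
    0≤U-cosine 0             _   {k} _   = 0≤U-1 k
    0≤U-cosine 1             m≢1 _          = contradiction ≡.refl m≢1
    0≤U-cosine (suc (suc k)) _   (inj₂ j≤m) = 0≤U-cosπ/ k j≤m

-- Orders of group elements, with infinite order encoded as 0.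

module OrderProperties {c ℓ} (G : Group c ℓ) where
  open Group G
  open Multiple rawMonoid using () renaming (_×_ to _times_)
  open SetoidReasoning setoid

  order-ε≡1 : ∀ {g} n → HasOrder G g n → g ≈ ε → n ≡ 1
  order-ε≡1 {g} zero          o       g≈ε = ⊥-elim (o 1 (ℕ.s≤s ℕ.z≤n) (trans (identityʳ g) g≈ε))
  order-ε≡1     (suc zero)    o       g≈ε = ≡.refl
  order-ε≡1 {g} (suc (suc n)) (_ , o) g≈ε =
    ⊥-elim (o 1 (ℕ.s≤s ℕ.z≤n) (ℕ.s≤s (ℕ.s≤s ℕ.z≤n)) (trans (identityʳ g) g≈ε))

  order-1⇒≈ε : ∀ {g} → HasOrder G g 1 → g ≈ ε
  order-1⇒≈ε {g} (g×1≈ε , _) = trans (sym (identityʳ g)) g×1≈ε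

  order-times : ∀ {g} n → HasOrder G g n → n times g ≈ ε
  order-times zero    _         = refl
  order-times (suc n) (g×n≈ε , _) = g×n≈ε

  -- The exponent that kills g kills h too, so minimality of `n` bounds it by `m`. The encoding of ∞
  -- as 0 splits the comparison into two parts.
  order-≤ : ∀ {g h} m n → (∀ k → k times g ≈ ε → k times h ≈ ε) →
            HasOrder G g m → HasOrder G h n → (n ≡ 0 → m ≡ 0) × (m ≢ 0 → n ℕ.≤ m)
  order-≤ m zero g⇒h og oh = n≡0⇒m≡0 m og , λ _ → ℕ.z≤n
    where
    n≡0⇒m≡0 : ∀ m → HasOrder G _ m → _ → m ≡ 0
    n≡0⇒m≡0 zero    _        _ = ≡.refl
    n≡0⇒m≡0 (suc m) (e , _) _ = ⊥-elim (oh (suc m) (ℕ.s≤s ℕ.z≤n) (g⇒h (suc m) e))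
  order-≤ zero    (suc n) g⇒h og oh = (λ ()) , λ 0≢0 → contradiction ≡.refl 0≢0
  order-≤ (suc m) (suc n) g⇒h (e , _) (_ , oh) = (λ ()) , λ _ →
    ℕ.≮⇒≥ λ m<n → oh (suc m) (ℕ.s≤s ℕ.z≤n) m<n (g⇒h (suc m) e)

  order-cong : ∀ {g h} m n → (∀ k → k times g ≈ ε → k times h ≈ ε) →
               (∀ k → k times h ≈ ε → k times g ≈ ε) →
               HasOrder G g m → HasOrder G h n → m ≡ n
  order-cong m n g⇒h h⇒g og oh with m ℕ.≟ 0 | n ℕ.≟ 0
  ... | yes m≡0 | _       = ≡.trans m≡0 (≡.sym (proj₁ (order-≤ n m h⇒g oh og) m≡0))
  ... | no m≢0  | yes n≡0 = contradiction (proj₁ (order-≤ m n g⇒h og oh) n≡0) m≢0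
  ... | no m≢0  | no n≢0  = ℕ.≤-antisym (proj₂ (order-≤ n m h⇒g oh og) n≢0)
                                        (proj₂ (order-≤ m n g⇒h og oh) m≢0)

-- Words, braid relations and parity in a Coxeter group.

module CoxeterProperties {a b} (C : CoxeterSystem a b) where
  open CoxeterSystem C
  open Multiple rawMonoid using () renaming (_×_ to _times_)
  open GroupProperties group using (inverseʳ-unique; inverseˡ-unique; ⁻¹-anti-homo-∙; ⁻¹-involutive; ε⁻¹≈ε)
  open OrderProperties group
  open SetoidReasoning setoid

  s² : ∀ i → s i ∙ s i ≈ ε
  s² i = trans (∙-congˡ (sym (identityʳ (s i)))) (order-times 2 (s-order i))

  s⁻¹ : ∀ i → s i ⁻¹ ≈ s i
  s⁻¹ i = sym (inverseʳ-unique (s i) (s i) (s² i))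

  s∙s∙ : ∀ i w → s i ∙ (s i ∙ w) ≈ w
  s∙s∙ i w = trans (sym (assoc _ _ _)) (trans (∙-congʳ (s² i)) (identityˡ w))

  ∙s∙s : ∀ w i → (w ∙ s i) ∙ s i ≈ w
  ∙s∙s w i = trans (assoc _ _ _) (trans (∙-congˡ (s² i)) (identityʳ w))

  s≉ε : ∀ i → ¬ (s i ≈ ε)
  s≉ε i sᵢ≈ε = proj₂ (s-order i) 1 (ℕ.s≤s ℕ.z≤n) (ℕ.s≤s (ℕ.s≤s ℕ.z≤n)) (trans (identityʳ _) sᵢ≈ε)

  m-diagonal : ∀ i → m i i ≡ 1
  m-diagonal i = order-ε≡1 (m i i) (m-order i i) (s² i)

  -- Order 1 would make `s i` the inverse of `s j`, hence equal to `s j`.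
  m-off-diagonal : ∀ {i j} → i ≢ j → m i j ≢ 1
  m-off-diagonal {i} {j} i≢j mᵢⱼ≡1 = i≢j (s-injective (trans
    (inverseˡ-unique (s i) (s j) (order-1⇒≈ε (≡.subst (HasOrder group _) mᵢⱼ≡1 (m-order i j))))
    (s⁻¹ j)))

  -- Conjugation by `s j` exchanges `s i ∙ s j` and `s j ∙ s i`. The two products therefore have the
  -- same order, and `m` is symmetric.
  s∙times : ∀ i j k → s j ∙ k times (s i ∙ s j) ≈ k times (s j ∙ s i) ∙ s j
  s∙times i j zero    = trans (identityʳ _) (sym (identityˡ _))
  s∙times i j (suc k) = begin
    s j ∙ ((s i ∙ s j) ∙ x)   ≈⟨ assoc _ _ _ ⟨
    (s j ∙ (s i ∙ s j)) ∙ x   ≈⟨ ∙-congʳ (assoc _ _ _) ⟨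
    ((s j ∙ s i) ∙ s j) ∙ x   ≈⟨ assoc _ _ _ ⟩
    (s j ∙ s i) ∙ (s j ∙ x)   ≈⟨ ∙-congˡ (s∙times i j k) ⟩
    (s j ∙ s i) ∙ (y ∙ s j)   ≈⟨ assoc _ _ _ ⟨
    ((s j ∙ s i) ∙ y) ∙ s j   ∎
    where
    x = k times (s i ∙ s j)
    y = k times (s j ∙ s i)

  times-swap : ∀ i j k → k times (s i ∙ s j) ≈ ε → k times (s j ∙ s i) ≈ ε
  times-swap i j k x≈ε = begin
    y                 ≈⟨ ∙s∙s y j ⟨
    (y ∙ s j) ∙ s j   ≈⟨ ∙-congʳ (s∙times i j k) ⟨
    (s j ∙ k times (s i ∙ s j)) ∙ s j  ≈⟨ ∙-congʳ (trans (∙-congˡ x≈ε) (identityʳ _)) ⟩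
    s j ∙ s j         ≈⟨ s² j ⟩
    ε                 ∎
    where y = k times (s j ∙ s i)

  m-sym : ∀ i j → m i j ≡ m j i
  m-sym i j = order-cong (m i j) (m j i) (times-swap i j) (times-swap j i) (m-order i j) (m-order j i)

  eval-++ : ∀ is js → eval (is ++ js) ≈ eval is ∙ eval js
  eval-++ []       js = sym (identityˡ _)
  eval-++ (i ∷ is) js = trans (∙-congˡ (eval-++ is js)) (sym (assoc _ _ _))

  eval-reverse : ∀ is → eval (reverse is) ≈ eval is ⁻¹
  eval-reverse []       = sym ε⁻¹≈ε
  eval-reverse (i ∷ is) = begin
    eval (reverse (i ∷ is))        ≡⟨ ≡.cong eval (List.unfold-reverse i is) ⟩
    eval (reverse is ++ [ i ])     ≈⟨ eval-++ (reverse is) [ i ] ⟩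
    eval (reverse is) ∙ eval [ i ] ≈⟨ ∙-cong (eval-reverse is) (trans (identityʳ (s i)) (sym (s⁻¹ i))) ⟩
    eval is ⁻¹ ∙ s i ⁻¹            ≈⟨ ⁻¹-anti-homo-∙ _ _ ⟨
    (s i ∙ eval is) ⁻¹             ∎

  alternating : ℕ → I → I → List I
  alternating zero    i j = []
  alternating (suc k) i j = i ∷ alternating k j i

  length-alternating : ∀ k i j → length (alternating k i j) ≡ k
  length-alternating zero    i j = ≡.refl
  length-alternating (suc k) i j = ≡.cong suc (length-alternating k j i)

  eval-alternating : ∀ k i j → eval (alternating (k ℕ.+ k) i j) ≈ k times (s i ∙ s j)
  eval-alternating zero    i j = refl
  eval-alternating (suc k) i j = begin
    s i ∙ eval (alternating (k ℕ.+ suc k) j i)        ≡⟨ ≡.cong (λ l → s i ∙ eval (alternating l j i)) (ℕ.+-suc k k) ⟩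
    s i ∙ (s j ∙ eval (alternating (k ℕ.+ k) i j))    ≈⟨ assoc _ _ _ ⟨
    (s i ∙ s j) ∙ eval (alternating (k ℕ.+ k) i j)    ≈⟨ ∙-congˡ (eval-alternating k i j) ⟩
    (s i ∙ s j) ∙ k times (s i ∙ s j)                 ∎

  -- Generators are involutions, so the letters of a trivial word can be carried to the other side
  -- one at a time. Each move changes the initial letter, which is why both alternating words are
  -- assumed trivial.
  braid-shift : ∀ a b i j → eval (alternating (a ℕ.+ b) i j) ≈ ε →
                eval (alternating (a ℕ.+ b) j i) ≈ ε →
                eval (alternating a i j) ≈ eval (alternating b j i)
  braid-shift a zero i j e _ =
    ≡.subst (λ l → eval (alternating l i j) ≈ ε) (ℕ.+-identityʳ a) e
  braid-shift a (suc b) i j e e′ = begin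
    eval (alternating a i j)                ≈⟨ s∙s∙ j _ ⟨
    s j ∙ eval (alternating (suc a) j i)    ≈⟨ ∙-congˡ (braid-shift (suc a) b j i (shift j i e′) (shift i j e)) ⟩
    s j ∙ eval (alternating b i j)          ∎
    where
    shift : ∀ i j → eval (alternating (a ℕ.+ suc b) i j) ≈ ε →
            eval (alternating (suc a ℕ.+ b) i j) ≈ ε
    shift i j = ≡.subst (λ l → eval (alternating l i j) ≈ ε) (ℕ.+-suc a b)

  braid : ∀ i j → eval (alternating (m i j) i j) ≈ eval (alternating (m i j) j i)
  braid i j = braid-shift (m i j) (m i j) i j
    (trans (eval-alternating (m i j) i j) ij≈ε)
    (trans (eval-alternating (m i j) j i) (times-swap i j (m i j) ij≈ε))
    where
    ij≈ε : m i j times (s i ∙ s j) ≈ ε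
    ij≈ε = order-times (m i j) (m-order i j)

  parity-++ : ∀ (u v : List I) → parity (length (u ++ v)) ≡ parity (length u) ℙ.+ parity (length v)
  parity-++ u v = ≡.trans (≡.cong parity (List.length-++ u)) (ℙ.+-homo-+ (length u) (length v))

  parity-relator : ∀ (i j : I) n → parity (length (concat (replicate n (i ∷ j ∷ [])))) ≡ 0ℙ
  parity-relator i j zero    = ≡.refl
  parity-relator i j (suc n) = parity-relator i j n

  parity-delete : ∀ {u v} → DeleteRelator u v → parity (length u) ≡ parity (length v)
  parity-delete (delete u v i j)
    rewrite parity-++ u (relator i j ++ v)
          | parity-++ (relator i j) v
          | parity-relator i j (m i j)
          | parity-++ u v = ≡.refl

  parity-~ : ∀ {u v} → u ~ v → parity (length u) ≡ parity (length v)
  parity-~ = EqClosure.gfold ≡.isEquivalence (parity ∘ length) parity-delete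

  -- All relators have even length. As the presentation only speaks of words for `ε`, it is applied
  -- to `is ++ reverse js`.
  parity-eval : ∀ is js → eval is ≈ eval js → parity (length is) ≡ parity (length js)
  parity-eval is js is≈js = cancel _ _ sum≡0ℙ
    where
    cancel : ∀ p q → p ℙ.+ q ≡ 0ℙ → p ≡ q
    cancel 0ℙ 0ℙ _ = ≡.refl
    cancel 1ℙ 1ℙ _ = ≡.refl

    is-js≈ε : eval (is ++ reverse js) ≈ ε
    is-js≈ε = trans (eval-++ is (reverse js))
      (trans (∙-cong is≈js (eval-reverse js)) (inverseʳ _))

    sum≡0ℙ : parity (length is) ℙ.+ parity (length js) ≡ 0ℙ
    sum≡0ℙ = ≡.trans (≡.cong (λ l → parity (length is) ℙ.+ parity l) (≡.sym (List.length-reverse js)))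
      (≡.trans (≡.sym (parity-++ is (reverse js)))
        (parity-~ (presented (is ++ reverse js) is-js≈ε)))

  -- The length function of a finite Coxeter group.

  module Length (finite : Finite group) where
    private
      module F = Inverse (proj₂ finite)

    _≈?_ : Decidable _≈_
    x ≈? y = Dec.map′ to-injective F.to-cong (F.to x Fin.≟ F.to y)
      where
      to-injective : F.to x ≡ F.to y → x ≈ y
      to-injective e = trans (sym (F.strictlyInverseʳ x)) (trans (F.from-cong e) (F.strictlyInverseʳ y))

    HasWord : Carrier → ℕ → Set _
    HasWord w k = ∃ λ is → eval is ≈ w × length is ≡ k

    -- Splitting off the first letter `i` leaves a word for `s i ∙ w`, so the search runs over the
    -- finitely many generators.
    hasWord? : ∀ w k → Dec (HasWord w k)
    hasWord? w zero    = Dec.map′ (λ ε≈w → [] , ε≈w , ≡.refl) (λ { ([] , ε≈w , _) → ε≈w }) (ε ≈? w)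
    hasWord? w (suc k) = Dec.map′
      (λ { (i , is , e , l) → i ∷ is , trans (∙-congˡ e) (s∙s∙ i w) , ≡.cong suc l })
      (λ { (i ∷ is , e , l) → i , is , trans (sym (s∙s∙ i _)) (∙-congˡ e) , ℕ.suc-injective l })
      (Fin.any? λ i → hasWord? (s i ∙ w) k)

    -- Only the specification of the length is used later; the search that finds it stays opaque.
    abstract
      hasLength : ∀ w → ∃ (HasLength w)
      hasLength w with generates w
      ... | is , e = least (length is) (<-wellFounded _) (is , e , ≡.refl)
        where
        least : ∀ k → Acc ℕ._<_ k → HasWord w k → ∃ (HasLength w)
        least k (acc rec) h with ℕ.anyUpTo? (hasWord? w) k
        ... | yes (j , j<k , h′) = least j (rec j<k) h′
        ... | no ∄shorter = k , h , λ js e′ → ℕ.≮⇒≥ λ js<k → ∄shorter (length js , js<k , js , e′ , ≡.refl)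

    ℓ : Carrier → ℕ
    ℓ w = proj₁ (hasLength w)

    reducedWord : Carrier → List I
    reducedWord w = proj₁ (proj₁ (proj₂ (hasLength w)))

    eval-reducedWord : ∀ w → eval (reducedWord w) ≈ w
    eval-reducedWord w = proj₁ (proj₂ (proj₁ (proj₂ (hasLength w))))

    length-reducedWord : ∀ w → length (reducedWord w) ≡ ℓ w
    length-reducedWord w = proj₂ (proj₂ (proj₁ (proj₂ (hasLength w))))

    ℓ-minimal : ∀ {w} is → eval is ≈ w → ℓ w ℕ.≤ length is
    ℓ-minimal {w} = proj₂ (proj₂ (hasLength w))

    ℓ-unique : ∀ {w k} → HasLength w k → ℓ w ≡ k
    ℓ-unique {w} ((is , e , ≡.refl) , minimal) = ℕ.≤-antisym (ℓ-minimal is e)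
      (flip ℕ.≤-trans (ℕ.≤-reflexive (length-reducedWord w)) (minimal (reducedWord w) (eval-reducedWord w)))

    ℓ-∙-eval : ∀ w is → ℓ (w ∙ eval is) ℕ.≤ ℓ w ℕ.+ length is
    ℓ-∙-eval w is = flip ℕ.≤-trans (ℕ.≤-reflexive
      (≡.trans (List.length-++ (reducedWord w)) (≡.cong (ℕ._+ length is) (length-reducedWord w))))
      (ℓ-minimal (reducedWord w ++ is)
        (trans (eval-++ (reducedWord w) is) (∙-congʳ (eval-reducedWord w))))

    ℓ-mono-≈ : ∀ {v w} → v ≈ w → ℓ v ℕ.≤ ℓ w
    ℓ-mono-≈ {v} {w} v≈w = flip ℕ.≤-trans (ℕ.≤-reflexive (length-reducedWord w))
      (ℓ-minimal (reducedWord w) (trans (eval-reducedWord w) (sym v≈w)))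

    ℓ-cong : ∀ {v w} → v ≈ w → ℓ v ≡ ℓ w
    ℓ-cong v≈w = ℕ.≤-antisym (ℓ-mono-≈ v≈w) (ℓ-mono-≈ (sym v≈w))

    ℓ-⁻¹-≤ : ∀ w → ℓ (w ⁻¹) ℕ.≤ ℓ w
    ℓ-⁻¹-≤ w = flip ℕ.≤-trans (ℕ.≤-reflexive (≡.trans (List.length-reverse (reducedWord w)) (length-reducedWord w)))
      (ℓ-minimal (reverse (reducedWord w))
        (trans (eval-reverse (reducedWord w)) (⁻¹-cong (eval-reducedWord w))))

    ℓ-⁻¹ : ∀ w → ℓ (w ⁻¹) ≡ ℓ w
    ℓ-⁻¹ w = ℕ.≤-antisym (ℓ-⁻¹-≤ w)
      (ℕ.≤-trans (ℓ-mono-≈ (sym (⁻¹-involutive w))) (ℓ-⁻¹-≤ (w ⁻¹)))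

    -- Appending a letter to a reduced word changes its parity, and parity depends only on the
    -- element.
    ℓ-∙s-≢ : ∀ w i → ℓ (w ∙ s i) ≢ ℓ w
    ℓ-∙s-≢ w i ℓws≡ℓw = p≢p⁻¹ (parity (ℓ w)) (≡.trans (≡.sym (ℙ.suc-homo-⁻¹ (ℓ w))) (≡.cong ℙ._⁻¹ parity-suc))
      where
      p≢p⁻¹ : ∀ p → p ≢ p ℙ.⁻¹
      p≢p⁻¹ 0ℙ ()
      p≢p⁻¹ 1ℙ ()

      parity-suc : parity (suc (ℓ w)) ≡ parity (ℓ w)
      parity-suc = ≡.trans (≡.cong parity suc≡length)
        (≡.trans (parity-eval (reducedWord w ++ [ i ]) (reducedWord (w ∙ s i)) e)
          (≡.cong parity (≡.trans (length-reducedWord (w ∙ s i)) ℓws≡ℓw)))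
        where
        suc≡length : suc (ℓ w) ≡ length (reducedWord w ++ [ i ])
        suc≡length = ≡.trans (ℕ.+-comm 1 (ℓ w))
          (≡.trans (≡.cong (ℕ._+ 1) (≡.sym (length-reducedWord w)))
            (≡.sym (List.length-++ (reducedWord w))))

        e : eval (reducedWord w ++ [ i ]) ≈ eval (reducedWord (w ∙ s i))
        e = trans (eval-++ (reducedWord w) [ i ])
          (trans (∙-cong (eval-reducedWord w) (identityʳ (s i))) (sym (eval-reducedWord (w ∙ s i))))

    ℓ-∙s-<⊎> : ∀ w i → ℓ (w ∙ s i) ℕ.< ℓ w ⊎ ℓ w ℕ.< ℓ (w ∙ s i)
    ℓ-∙s-<⊎> w i with ℕ.<-cmp (ℓ (w ∙ s i)) (ℓ w)
    ... | tri< ws<w _ _ = inj₁ ws<w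
    ... | tri≈ _ ws≡w _ = contradiction ws≡w (ℓ-∙s-≢ w i)
    ... | tri> _ _ w<ws = inj₂ w<ws

-- The simple reflections of V and the relations they satisfy.

module Reflections
  {c ℓ₁ ℓ₂ ℓ₃ w ℓ}
  (R : Reals c ℓ₁ ℓ₂ ℓ₃) (cosπ/ : ℕ → Reals.Carrier R)
  (isCosπ/ : Trigonometry.IsCosπ/-function R cosπ/)
  (C : CoxeterSystem w ℓ)
  where

  open Reals R hiding (zero)
  open OrderedField R
  open Chebyshev R
  open RootSystem R cosπ/ C using (V; _≋_; α; -cosπ/; B; reflect)
  open CoxeterSystem C using (I; m; relator)
  open CoxeterProperties C using (m-diagonal; m-off-diagonal; m-sym)
  open Sum (CommutativeRing.semiring commutativeRing)
    using (sum; sum-cong-≋; ∑-distrib-+; *-distribˡ-sum)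
  open SetoidReasoning (CommutativeRing.setoid commutativeRing)

  ≋-refl : ∀ {β} → β ≋ β
  ≋-refl k = refl

  ≋-sym : ∀ {β γ} → β ≋ γ → γ ≋ β
  ≋-sym β≋γ k = sym (β≋γ k)

  ≋-trans : ∀ {β γ δ} → β ≋ γ → γ ≋ δ → β ≋ δ
  ≋-trans β≋γ γ≋δ k = trans (β≋γ k) (γ≋δ k)

  lin : Carrier → V → Carrier → V → V
  lin a β b γ k = a * β k + b * γ k

  record IsLinear (f : V → V) : Set (c ⊔ ℓ₁) where
    field
      cong : ∀ {β γ} → β ≋ γ → f β ≋ f γ
      homo : ∀ a β b γ → f (lin a β b γ) ≋ lin a (f β) b (f γ)

  sum-indicator : ∀ {n} (x : Fin n → Carrier) k →
    sum (λ j → x j * (if does (j Fin.≟ k) then 1# else 0#)) ≈ x k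
  sum-indicator x zero = trans
    (+-cong (*-identityʳ (x zero)) (sum-zero (x ∘ suc)))
    (+-identityʳ (x zero))
    where
    sum-zero : ∀ {n} (x : Fin n → Carrier) → sum (λ j → x j * 0#) ≈ 0#
    sum-zero {zero}  x = refl
    sum-zero {suc n} x = trans (+-cong (zeroʳ (x zero)) (sum-zero (x ∘ suc))) (+-identityˡ 0#)
  sum-indicator x (suc k) = trans
    (+-cong (zeroʳ (x zero)) (sum-indicator (x ∘ suc) k))
    (+-identityˡ (x (suc k)))

  α-sym : ∀ i j → α i j ≡ α j i
  α-sym i j with i Fin.≟ j | j Fin.≟ i
  ... | yes _   | yes _   = ≡.refl
  ... | yes i≡j | no j≢i  = contradiction (≡.sym i≡j) j≢i
  ... | no i≢j  | yes j≡i = contradiction (≡.sym j≡i) i≢j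
  ... | no _    | no _    = ≡.refl

  α-refl : ∀ i → α i i ≡ 1#
  α-refl i with i Fin.≟ i
  ... | yes _  = ≡.refl
  ... | no i≢i = contradiction ≡.refl i≢i

  α-≢ : ∀ {i j} → i ≢ j → α i j ≡ 0#
  α-≢ {i} {j} i≢j with i Fin.≟ j
  ... | yes i≡j = contradiction i≡j i≢j
  ... | no _    = ≡.refl

  linear-sum : ∀ {f} → IsLinear f → ∀ {n} (φ : Fin n → V) →
    f (λ k → sum (λ j → φ j k)) ≋ (λ k → sum (λ j → f (φ j) k))
  linear-sum {f} f-linear {zero} φ k = begin
    f (λ _ → 0#) k                             ≈⟨ cong (λ _ → solve 0 (con (+ 0) := con (+ 0) :* con (+ 0) :+ con (+ 0) :* con (+ 0)) refl) k ⟩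
    f (lin 0# (λ _ → 0#) 0# (λ _ → 0#)) k      ≈⟨ homo 0# _ 0# _ k ⟩
    0# * _ + 0# * _                            ≈⟨ solve 1 (λ x → con (+ 0) :* x :+ con (+ 0) :* x := con (+ 0)) refl _ ⟩
    0#                                         ∎
    where open IsLinear f-linear
  linear-sum {f} f-linear {suc n} φ k = begin
    f (λ k → φ zero k + rest k) k     ≈⟨ cong (λ k → sym (1*+1* _ _)) k ⟩
    f (lin 1# (φ zero) 1# rest) k     ≈⟨ homo 1# _ 1# _ k ⟩
    1# * f (φ zero) k + 1# * f rest k ≈⟨ 1*+1* _ _ ⟩
    f (φ zero) k + f rest k           ≈⟨ +-congˡ (linear-sum f-linear (φ ∘ suc) k) ⟩
    f (φ zero) k + sum (λ j → f (φ (suc j)) k)  ∎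
    where
    open IsLinear f-linear
    rest : V
    rest k = sum (λ j → φ (suc j) k)
    1*+1* : ∀ x y → 1# * x + 1# * y ≈ x + y
    1*+1* x y = +-cong (*-identityˡ x) (*-identityˡ y)

  linear-expansion : ∀ {f} → IsLinear f → ∀ β → f β ≋ λ k → sum (λ j → β j * f (α j) k)
  linear-expansion {f} f-linear β k = begin
    f β k                                    ≈⟨ cong (λ k → sym (sum-indicator β k)) k ⟩
    f (λ k → sum (λ j → β j * α j k)) k      ≈⟨ linear-sum f-linear (λ j k → β j * α j k) k ⟩
    sum (λ j → f (λ k → β j * α j k) k)      ≈⟨ sum-cong-≋ (λ j → scale (β j) (α j) k) ⟩
    sum (λ j → β j * f (α j) k)              ∎
    where
    open IsLinear f-linear
    scale : ∀ a γ → f (λ k → a * γ k) ≋ λ k → a * f γ k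
    scale a γ k = begin
      f (λ k → a * γ k) k         ≈⟨ cong (λ k → drop a (γ k)) k ⟩
      f (lin a γ 0# γ) k          ≈⟨ homo a γ 0# γ k ⟩
      a * f γ k + 0# * f γ k      ≈⟨ drop a (f γ k) ⟨
      a * f γ k                   ∎
      where
      drop : ∀ a x → a * x ≈ a * x + 0# * x
      drop = solve 2 (λ a x → a :* x := a :* x :+ con (+ 0) :* x) refl

  -- The form `B` against a simple root, with its double sum collapsed to a single one.
  ⟨_,α_⟩ : V → I → Carrier
  ⟨ β ,α i ⟩ = sum λ j → β j * -cosπ/ (m j i)

  B≈⟨,α⟩ : ∀ β i → B β (α i) ≈ ⟨ β ,α i ⟩
  B≈⟨,α⟩ β i = sum-cong-≋ λ a → begin
    sum (λ b → (β a * α i b) * -cosπ/ (m a b))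
      ≈⟨ sum-cong-≋ (λ b → trans
           (solve 3 (λ x y z → (x :* y) :* z := (x :* z) :* y) refl (β a) (α i b) (-cosπ/ (m a b)))
           (*-congˡ (reflexive (α-sym i b)))) ⟩
    sum (λ b → (β a * -cosπ/ (m a b)) * α b i)
      ≈⟨ sum-indicator (λ b → β a * -cosπ/ (m a b)) i ⟩
    β a * -cosπ/ (m a i) ∎

  ⟨,α⟩-cong : ∀ {β γ} → β ≋ γ → ∀ i → ⟨ β ,α i ⟩ ≈ ⟨ γ ,α i ⟩
  ⟨,α⟩-cong β≋γ i = sum-cong-≋ λ j → *-congʳ (β≋γ j)

  ⟨,α⟩-lin : ∀ a β b γ i → ⟨ lin a β b γ ,α i ⟩ ≈ a * ⟨ β ,α i ⟩ + b * ⟨ γ ,α i ⟩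
  ⟨,α⟩-lin a β b γ i = begin
    sum (λ j → lin a β b γ j * g j)
      ≈⟨ sum-cong-≋ (λ j →
           solve 5 (λ a x b y g → (a :* x :+ b :* y) :* g := a :* (x :* g) :+ b :* (y :* g))
             refl a (β j) b (γ j) (g j)) ⟩
    sum (λ j → a * (β j * g j) + b * (γ j * g j))
      ≈⟨ ∑-distrib-+ (λ j → a * (β j * g j)) (λ j → b * (γ j * g j)) ⟩
    sum (λ j → a * (β j * g j)) + sum (λ j → b * (γ j * g j))
      ≈⟨ +-cong (*-distribˡ-sum a (λ j → β j * g j)) (*-distribˡ-sum b (λ j → γ j * g j)) ⟨
    a * ⟨ β ,α i ⟩ + b * ⟨ γ ,α i ⟩ ∎
    where
    g : I → Carrier
    g j = -cosπ/ (m j i)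

  ⟨α,α⟩ : ∀ j i → ⟨ α j ,α i ⟩ ≈ -cosπ/ (m j i)
  ⟨α,α⟩ j i = trans
    (sum-cong-≋ (λ k → trans (*-comm _ _) (*-congˡ (reflexive (α-sym j k)))))
    (sum-indicator (λ k → -cosπ/ (m k i)) j)

  -cosπ/≈-cosine : ∀ n → -cosπ/ n ≈ - cosine cosπ/ n
  -cosπ/≈-cosine zero    = refl
  -cosπ/≈-cosine (suc n) = refl

  ⟨α,α⟩-diagonal : ∀ i → ⟨ α i ,α i ⟩ ≈ 1#
  ⟨α,α⟩-diagonal i = begin
    ⟨ α i ,α i ⟩      ≈⟨ ⟨α,α⟩ i i ⟩
    -cosπ/ (m i i)    ≡⟨ ≡.cong -cosπ/ (m-diagonal i) ⟩
    - cosπ/ 1         ≈⟨ -‿cong (cosπ/1≈-1 isCosπ/) ⟩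
    - - 1#            ≈⟨ solve 0 (:- (:- con (+ 1)) := con (+ 1)) refl ⟩
    1#                ∎

  reflect-≋ : ∀ i β → reflect i β ≋ λ k → β k - ((1# + 1#) * ⟨ β ,α i ⟩) * α i k
  reflect-≋ i β k = +-congˡ (-‿cong (*-congʳ (*-congˡ (B≈⟨,α⟩ β i))))

  reflect-isLinear : ∀ i → IsLinear (reflect i)
  reflect-isLinear i = record
    { cong = λ {β} {γ} β≋γ k → begin
        reflect i β k                                  ≈⟨ reflect-≋ i β k ⟩
        β k - ((1# + 1#) * ⟨ β ,α i ⟩) * α i k
          ≈⟨ +-cong (β≋γ k) (-‿cong (*-congʳ (*-congˡ (⟨,α⟩-cong β≋γ i)))) ⟩
        γ k - ((1# + 1#) * ⟨ γ ,α i ⟩) * α i k         ≈⟨ reflect-≋ i γ k ⟨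
        reflect i γ k                                  ∎
    ; homo = λ a β b γ k → begin
        reflect i (lin a β b γ) k                      ≈⟨ reflect-≋ i (lin a β b γ) k ⟩
        lin a β b γ k - ((1# + 1#) * ⟨ lin a β b γ ,α i ⟩) * α i k
          ≈⟨ +-congˡ (-‿cong (*-congʳ (*-congˡ (⟨,α⟩-lin a β b γ i)))) ⟩
        (a * β k + b * γ k) - ((1# + 1#) * (a * ⟨ β ,α i ⟩ + b * ⟨ γ ,α i ⟩)) * α i k
          ≈⟨ solve 8 (λ t a x b y u v z →
               (a :* x :+ b :* y) :- (t :* (a :* u :+ b :* v)) :* z :=
               a :* (x :- (t :* u) :* z) :+ b :* (y :- (t :* v) :* z))
             refl (1# + 1#) a (β k) b (γ k) ⟨ β ,α i ⟩ ⟨ γ ,α i ⟩ (α i k) ⟩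
        a * (β k - ((1# + 1#) * ⟨ β ,α i ⟩) * α i k) + b * (γ k - ((1# + 1#) * ⟨ γ ,α i ⟩) * α i k)
          ≈⟨ +-cong (*-congˡ (reflect-≋ i β k)) (*-congˡ (reflect-≋ i γ k)) ⟨
        lin a (reflect i β) b (reflect i γ) k          ∎
    }

  act : List I → V → V
  act is β = foldr reflect β is

  act-isLinear : ∀ is → IsLinear (act is)
  act-isLinear [] = record { cong = λ β≋γ → β≋γ ; homo = λ _ _ _ _ _ → refl }
  act-isLinear (i ∷ is) = record
    { cong = r.cong ∘ a.cong
    ; homo = λ a β b γ → ≋-trans (r.cong (a.homo a β b γ)) (r.homo a (act is β) b (act is γ))
    }
    where
    module r = IsLinear (reflect-isLinear i)
    module a = IsLinear (act-isLinear is)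

  act-cong : ∀ is {β γ} → β ≋ γ → act is β ≋ act is γ
  act-cong is = IsLinear.cong (act-isLinear is)

  act-++ : ∀ is js β → act (is ++ js) β ≡ act is (act js β)
  act-++ is js β = List.foldr-++ reflect β is js

  -- The reflections in α_i and α_j keep β inside β + span(α_i, α_j); `a` and `b` are coordinates on
  -- this plane.
  shift : V → Carrier → I → Carrier → I → V
  shift β a i b j k = β k + (a * α i k + b * α j k)

  shift-swap : ∀ β a i b j → shift β a i b j ≋ shift β b j a i
  shift-swap β a i b j k = +-congˡ (+-comm _ _)

  shift-cong : ∀ β {a a′} i {b b′} j → a ≈ a′ → b ≈ b′ → shift β a i b j ≋ shift β a′ i b′ j
  shift-cong β i j a≈a′ b≈b′ k = +-congˡ (+-cong (*-congʳ a≈a′) (*-congʳ b≈b′))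

  -- Since B(α_j, α_j) = 1, the coordinate b changes sign; the other two terms come from B(α_i, α_j)
  -- and B(β, α_j). Apart from the last term this is the Chebyshev recurrence.
  reflect-shift : ∀ β a i b j →
    reflect j (shift β a i b j) ≋
    shift β a i ((cosine cosπ/ (m i j) + cosine cosπ/ (m i j)) * a - b - (1# + 1#) * ⟨ β ,α j ⟩) j
  reflect-shift β a i b j k = begin
    reflect j δ k
      ≈⟨ reflect-≋ j δ k ⟩
    δ k - ((1# + 1#) * ⟨ δ ,α j ⟩) * α j k
      ≈⟨ +-congˡ (-‿cong (*-congʳ (*-congˡ ⟨δ,α⟩))) ⟩
    δ k - ((1# + 1#) * (⟨ β ,α j ⟩ + (a * - x + b * 1#))) * α j k
      ≈⟨ solve 7 (λ a b x p u y z →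
           let two = con (+ 1) :+ con (+ 1) in
           u :+ (a :* y :+ b :* z) :- (two :* (p :+ (a :* (:- x) :+ b :* con (+ 1)))) :* z :=
           u :+ (a :* y :+ ((x :+ x) :* a :- b :- two :* p) :* z))
         refl a b x ⟨ β ,α j ⟩ (β k) (α i k) (α j k) ⟩
    β k + (a * α i k + ((x + x) * a - b - (1# + 1#) * ⟨ β ,α j ⟩) * α j k) ∎
    where
    x = cosine cosπ/ (m i j)
    δ = shift β a i b j
    γ = lin a (α i) b (α j)
    ⟨δ,α⟩ : ⟨ δ ,α j ⟩ ≈ ⟨ β ,α j ⟩ + (a * - x + b * 1#)
    ⟨δ,α⟩ = begin
      ⟨ δ ,α j ⟩                              ≈⟨ ⟨,α⟩-cong (λ k → sym (+-cong (*-identityˡ _) (*-identityˡ _))) j ⟩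
      ⟨ lin 1# β 1# γ ,α j ⟩                  ≈⟨ ⟨,α⟩-lin 1# β 1# γ j ⟩
      1# * ⟨ β ,α j ⟩ + 1# * ⟨ γ ,α j ⟩       ≈⟨ +-cong (*-identityˡ _) (*-identityˡ _) ⟩
      ⟨ β ,α j ⟩ + ⟨ γ ,α j ⟩                 ≈⟨ +-congˡ (⟨,α⟩-lin a (α i) b (α j) j) ⟩
      ⟨ β ,α j ⟩ + (a * ⟨ α i ,α j ⟩ + b * ⟨ α j ,α j ⟩)
        ≈⟨ +-congˡ (+-cong (*-congˡ (trans (⟨α,α⟩ i j) (-cosπ/≈-cosine (m i j)))) (*-congˡ (⟨α,α⟩-diagonal j))) ⟩
      ⟨ β ,α j ⟩ + (a * - x + b * 1#)         ∎

  reflect-negates-α : ∀ i → reflect i (α i) ≋ λ k → - α i k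
  reflect-negates-α i k = begin
    reflect i (α i) k                            ≈⟨ reflect-≋ i (α i) k ⟩
    α i k - ((1# + 1#) * ⟨ α i ,α i ⟩) * α i k   ≈⟨ +-congˡ (-‿cong (*-congʳ (*-congˡ (⟨α,α⟩-diagonal i)))) ⟩
    α i k - ((1# + 1#) * 1#) * α i k
      ≈⟨ solve 1 (λ x → x :- ((con (+ 1) :+ con (+ 1)) :* con (+ 1)) :* x := :- x) refl (α i k) ⟩
    - α i k                                      ∎

  reflect-involutive : ∀ i β → reflect i (reflect i β) ≋ β
  reflect-involutive i β k = begin
    reflect i (reflect i β) k                              ≈⟨ cong (reflect-≋′ β) k ⟩
    reflect i (lin 1# β (- t) (α i)) k                     ≈⟨ homo 1# β (- t) (α i) k ⟩
    1# * reflect i β k + - t * reflect i (α i) k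
      ≈⟨ +-cong (*-congˡ (reflect-≋ i β k)) (*-congˡ (reflect-negates-α i k)) ⟩
    1# * (β k - t * α i k) + - t * - α i k
      ≈⟨ solve 3 (λ x t a → con (+ 1) :* (x :- t :* a) :+ (:- t) :* (:- a) := x) refl (β k) t (α i k) ⟩
    β k                                                    ∎
    where
    open IsLinear (reflect-isLinear i)
    t = (1# + 1#) * ⟨ β ,α i ⟩
    reflect-≋′ : ∀ β → reflect i β ≋ lin 1# β (- ((1# + 1#) * ⟨ β ,α i ⟩)) (α i)
    reflect-≋′ β k = trans (reflect-≋ i β k)
      (solve 3 (λ x t a → x :- t :* a := con (+ 1) :* x :+ (:- t) :* a) refl (β k) _ (α i k))

  act-reverse : ∀ is β → act (reverse is) (act is β) ≋ β
  act-reverse []       β = ≋-refl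
  act-reverse (i ∷ is) β
    rewrite List.unfold-reverse i is
          | act-++ (reverse is) [ i ] (reflect i (act is β)) =
    ≋-trans (act-cong (reverse is) (reflect-involutive i (act is β))) (act-reverse is β)

  -- The closed form in powers shows that the coefficients of (s_i s_j)^n β − β in
  -- α i and α j are divisible by U x n = sin nθ / sin θ, which vanishes at n = m i j.
  act-relator : ∀ i j → m i j ≢ 1 → ∀ β → act (relator i j) β ≋ β
  act-relator i j mᵢⱼ≢1 β k = begin
    act (relator i j) β k                                  ≈⟨ powers (m i j) k ⟩
    β k + (coefᵢ uₘ vₘ * α i k + coefⱼ uₘ vₘ * α j k)          ≈⟨ +-congˡ (+-cong (*-congʳ coefᵢ≈0) (*-congʳ coefⱼ≈0)) ⟩
    β k + (0# * α i k + 0# * α j k)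
      ≈⟨ solve 3 (λ x a b → x :+ (con (+ 0) :* a :+ con (+ 0) :* b) := x) refl (β k) (α i k) (α j k) ⟩
    β k                                                    ∎
    where
    x = cosine cosπ/ (m i j)
    uₘ = U x (m i j)
    vₘ = U x (suc (m i j))
    μ = ⟨ β ,α j ⟩
    ν = ⟨ β ,α i ⟩

    coefᵢ coefⱼ : Carrier → Carrier → Carrier
    coefᵢ u v = - ((1# + 1#) * (u * (μ * v + ν * u)))
    coefⱼ u v = - ((1# + 1#) * (u * (μ * u + ν * ((x + x) * u - v))))

    u≈0⇒≈0 : ∀ y → - ((1# + 1#) * (uₘ * y)) ≈ 0#
    u≈0⇒≈0 y = trans (-‿cong (*-congˡ (*-congʳ (U-cosine≈0 isCosπ/ (m i j) mᵢⱼ≢1))))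
      (solve 1 (λ y → :- ((con (+ 1) :+ con (+ 1)) :* (con (+ 0) :* y)) := con (+ 0)) refl y)

    coefᵢ≈0 : coefᵢ uₘ vₘ ≈ 0#
    coefᵢ≈0 = u≈0⇒≈0 _

    coefⱼ≈0 : coefⱼ uₘ vₘ ≈ 0#
    coefⱼ≈0 = u≈0⇒≈0 _

    stepⱼ : ∀ n → let u = U x n ; v = U x (suc n) in
      (x + x) * coefᵢ u v - coefⱼ u v - (1# + 1#) * μ ≈ coefⱼ v (U x (suc (suc n)))
    stepⱼ n = begin
      d * coefᵢ u v - coefⱼ u v - (1# + 1#) * μ
        -- Multiplying by the invariant makes the constant term quadratic in u and v; what remains
        -- is a polynomial identity.
        ≈⟨ +-congˡ (-‿cong (*-congˡ (trans (sym (*-identityʳ μ)) (*-congˡ (sym (U-invariant x n)))))) ⟩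
      d * coefᵢ u v - coefⱼ u v - (1# + 1#) * (μ * (u * u + v * v - d * (u * v)))
        ≈⟨ solve 5 (λ u v d μ ν →
             let two = con (+ 1) :+ con (+ 1)
                 cᵢ = :- (two :* (u :* (μ :* v :+ ν :* u)))
                 cⱼ = λ u v → :- (two :* (u :* (μ :* u :+ ν :* (d :* u :- v))))
             in d :* cᵢ :- cⱼ u v :- two :* (μ :* (u :* u :+ v :* v :- d :* (u :* v)))
                  := cⱼ v (d :* v :- u))
           refl u v d μ ν ⟩
      coefⱼ v (d * v - u) ∎
      where
      d = x + x
      u = U x n
      v = U x (suc n)

    stepᵢ : ∀ n → let v = U x (suc n) ; w = U x (suc (suc n)) in
      (x + x) * coefⱼ v w - coefᵢ (U x n) v - (1# + 1#) * ν ≈ coefᵢ v w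
    stepᵢ n = begin
      d * coefⱼ v (d * v - u) - coefᵢ u v - (1# + 1#) * ν
        ≈⟨ +-congˡ (-‿cong (*-congˡ (trans (sym (*-identityʳ ν)) (*-congˡ (sym (U-invariant x n)))))) ⟩
      d * coefⱼ v (d * v - u) - coefᵢ u v - (1# + 1#) * (ν * (u * u + v * v - d * (u * v)))
        ≈⟨ solve 5 (λ u v d μ ν →
             let two = con (+ 1) :+ con (+ 1)
                 w = d :* v :- u
                 cᵢ = λ u v → :- (two :* (u :* (μ :* v :+ ν :* u)))
                 cⱼ = :- (two :* (v :* (μ :* v :+ ν :* (d :* v :- w))))
             in d :* cⱼ :- cᵢ u v :- two :* (ν :* (u :* u :+ v :* v :- d :* (u :* v)))
                  := cᵢ v w)
           refl u v d μ ν ⟩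
      coefᵢ v (d * v - u) ∎
      where
      d = x + x
      u = U x n
      v = U x (suc n)

    reflectᵢ : ∀ a b → reflect i (shift β a i b j) ≋
                       shift β ((x + x) * b - a - (1# + 1#) * ν) i b j
    reflectᵢ a b = ≋-trans (IsLinear.cong (reflect-isLinear i) (shift-swap β a i b j))
      (≋-trans (≡.subst (λ n → reflect i (shift β b j a i) ≋
                               shift β b j ((cosine cosπ/ n + cosine cosπ/ n) * b - a - (1# + 1#) * ν) i)
                        (m-sym j i) (reflect-shift β b j a i))
        (shift-swap β b j _ i))

    powers : ∀ n → act (concat (replicate n (i ∷ j ∷ []))) β ≋
                   shift β (coefᵢ (U x n) (U x (suc n))) i (coefⱼ (U x n) (U x (suc n))) j
    powers zero k = solve 6 (λ y a b d μ ν →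
        let two = con (+ 1) :+ con (+ 1) in
        y := y :+ ((:- (two :* (con (+ 0) :* (μ :* con (+ 1) :+ ν :* con (+ 0))))) :* a
               :+ (:- (two :* (con (+ 0) :* (μ :* con (+ 0) :+ ν :* (d :* con (+ 0) :- con (+ 1)))))) :* b))
      refl (β k) (α i k) (α j k) (x + x) μ ν
    powers (suc n) =
      -- The reflection in α_j acts first and advances its own coefficient, while that of α_i is
      -- still at n; the reflection in α_i then catches up.
      ≋-trans (r.cong (≋-trans (rⱼ.cong (powers n)) (≋-trans (reflect-shift β _ i _ j) (shift-cong β i j refl (stepⱼ n)))))
        (≋-trans (reflectᵢ _ _) (shift-cong β i j (stepᵢ n) refl))
      where
      module r = IsLinear (reflect-isLinear i)
      module rⱼ = IsLinear (reflect-isLinear j)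

-- The action of W on V and positivity.

module Roots
  {c ℓ₁ ℓ₂ ℓ₃ w ℓ′}
  (R : Reals c ℓ₁ ℓ₂ ℓ₃) (cosπ/ : ℕ → Reals.Carrier R)
  (isCosπ/ : Trigonometry.IsCosπ/-function R cosπ/)
  (C : CoxeterSystem w ℓ′)
  where

  open RootSystem R cosπ/ C
  open CoxeterSystem C hiding (_-_)
  open CoxeterProperties C public
  open Reflections R cosπ/ isCosπ/ C public
  open Chebyshev R
  open OrderedField R
  private module ℝ = Reals R
  open ℝ using (0#; 1#; _+_; _*_; _-_; -_; _≤_) renaming (_≈_ to _≈ᴿ_; Carrier to ℝ)

  act-~ : ∀ {is js} → is ~ js → ∀ β → act is β ≋ act js β
  act-~ = EqClosure.fold
    (record { refl = λ _ → ≋-refl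
            ; sym = λ e β → ≋-sym (e β)
            ; trans = λ e e′ β → ≋-trans (e β) (e′ β) })
    act-delete
    where
    act-relator′ : ∀ i j β → act (relator i j) β ≋ β
    act-relator′ i j β with i Fin.≟ j
    ... | no i≢j = act-relator i j (m-off-diagonal i≢j) β
    -- On the diagonal m = 1, the case excluded from `act-relator`; the relator is then a repeated
    -- letter.
    ... | yes ≡.refl rewrite m-diagonal i = reflect-involutive i β

    act-delete : ∀ {is js} → DeleteRelator is js → ∀ β → act is β ≋ act js β
    act-delete (delete u v i j) β
      rewrite act-++ u (relator i j ++ v) β | act-++ (relator i j) v β | act-++ u v β =
      act-cong u (act-relator′ i j (act v β))

  -- This makes the action independent of the word supplied by `generates`. Inserting `reverse js`
  -- after `js` reduces the claim to a word for `ε`, which the relators contract to the empty word.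
  act-eval : ∀ is js → eval is ≈ eval js → ∀ β → act is β ≋ act js β
  act-eval is js is≈js β = ≋-trans (act-cong is (≋-sym (act-reverse js β)))
    (≋-trans (λ k → ℝ.reflexive (≡.cong (λ γ → γ k) (≡.sym (act-++ is (reverse js) (act js β)))))
      (act-~ (presented (is ++ reverse js) is-js≈ε) (act js β)))
    where
    is-js≈ε : eval (is ++ reverse js) ≈ ε
    is-js≈ε = trans (eval-++ is (reverse js))
      (trans (∙-cong is≈js (eval-reverse js)) (inverseʳ _))

  ·-eval : ∀ {v} is → eval is ≈ v → ∀ β → v · β ≋ act is β
  ·-eval {v} is is≈v = act-eval (proj₁ (generates v)) is (trans (proj₂ (generates v)) (sym is≈v))

  ·-isLinear : ∀ v → IsLinear (v ·_)
  ·-isLinear v = act-isLinear (proj₁ (generates v))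

  ·-congˡ : ∀ v {β γ} → β ≋ γ → v · β ≋ v · γ
  ·-congˡ v = IsLinear.cong (·-isLinear v)

  ·-congʳ : ∀ {u v} → u ≈ v → ∀ β → u · β ≋ v · β
  ·-congʳ {u} {v} u≈v = ·-eval (proj₁ (generates v)) (trans (proj₂ (generates v)) (sym u≈v))

  ·-∙ : ∀ u v β → (u ∙ v) · β ≋ u · v · β
  ·-∙ u v β = ≋-trans
    (·-eval (is ++ js) (trans (eval-++ is js) (∙-cong (proj₂ (generates u)) (proj₂ (generates v)))) β)
    (λ k → ℝ.reflexive (≡.cong (λ γ → γ k) (act-++ is js β)))
    where
    is = proj₁ (generates u)
    js = proj₁ (generates v)

  ·-ε : ∀ β → ε · β ≋ β
  ·-ε = ·-eval [] refl

  ·-s : ∀ i β → s i · β ≋ reflect i β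
  ·-s i = ·-eval [ i ] (identityʳ (s i))

  ·-⁻¹ : ∀ v β → v · v ⁻¹ · β ≋ β
  ·-⁻¹ v β = ≋-trans (≋-sym (·-∙ v (v ⁻¹) β)) (≋-trans (·-congʳ (inverseʳ v) β) (·-ε β))

  ⁻¹-· : ∀ v β → v ⁻¹ · v · β ≋ β
  ⁻¹-· v β = ≋-trans (≋-sym (·-∙ (v ⁻¹) v β)) (≋-trans (·-congʳ (inverseˡ v) β) (·-ε β))

  infix 8 ⁻_
  ⁻_ : V → V
  (⁻ β) k = - β k

  ·-neg : ∀ v β → v · ⁻ β ≋ ⁻ (v · β)
  ·-neg v β k = ℝ.trans
    (·-congˡ v (λ k → solve 1 (λ b → :- b := (:- con (+ 1)) :* b :+ con (+ 0) :* b) ℝ.refl (β k)) k)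
    (ℝ.trans (IsLinear.homo (·-isLinear v) (- 1#) β 0# β k)
      (solve 1 (λ b → (:- con (+ 1)) :* b :+ con (+ 0) :* b := :- b) ℝ.refl ((v · β) k)))

  ·-s-α : ∀ i → s i · α i ≋ ⁻ α i
  ·-s-α i = ≋-trans (·-s i (α i)) (reflect-negates-α i)

  -- Membership in `Φ` is left out, so that nonnegative combinations stay inside.
  Pos : V → Set ℓ₃
  Pos β = ∀ k → 0# ≤ β k

  Pos-≋ : ∀ {β γ} → β ≋ γ → Pos β → Pos γ
  Pos-≋ β≋γ p k = ≤-respʳ-≈ (β≋γ k) (p k)

  Pos-lin : ∀ {a β b γ} → 0# ≤ a → Pos β → 0# ≤ b → Pos γ → Pos (lin a β b γ)
  Pos-lin 0≤a p 0≤b q k = 0≤-+ (0≤-* 0≤a (p k)) (0≤-* 0≤b (q k))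

  α-Pos : ∀ i → Pos (α i)
  α-Pos i k with i Fin.≟ k
  ... | yes _ = 0<⇒0≤ 0<1
  ... | no _  = ≈0⇒0≤ ℝ.refl

  -- For x = cos θ these are the roots (sin((k+1)θ) α_p + sin(kθ) α_q) / sin θ of the rank-two
  -- subsystem, obtained from a simple root by k alternating reflections; the next one to apply is
  -- that in α_q.
  dihedralRoot : ℝ → ℕ → I → I → V
  dihedralRoot x k p q = lin (U x (suc k)) (α p) (U x k) (α q)

  reflect-dihedralRoot : ∀ k p q → let x = cosine cosπ/ (m p q) in
    reflect q (dihedralRoot x k p q) ≋ dihedralRoot x (suc k) q p
  reflect-dihedralRoot k p q =
    -- Over the zero vector, `reflect-shift` has no inhomogeneous term and is exactly the recurrence
    -- of `U`.
    ≋-trans (IsLinear.cong (reflect-isLinear q) (λ k → ℝ.sym (ℝ.+-identityˡ _)))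
      (≋-trans (reflect-shift (λ _ → 0#) _ p _ q) tidy)
    where
    x = cosine cosπ/ (m p q)
    u = U x k
    v = U x (suc k)
    ⟨0,α⟩ : ⟨ (λ _ → 0#) ,α q ⟩ ≈ᴿ 0#
    ⟨0,α⟩ = ℝ.trans
      (⟨,α⟩-cong (λ _ → solve 1 (λ y → con (+ 0) := con (+ 0) :* y :+ con (+ 0) :* y) ℝ.refl 0#) q)
      (ℝ.trans (⟨,α⟩-lin 0# (λ _ → 0#) 0# (λ _ → 0#) q)
        (solve 1 (λ y → con (+ 0) :* y :+ con (+ 0) :* y := con (+ 0)) ℝ.refl _))
    tidy : shift (λ _ → 0#) v p ((x + x) * v - u - (1# + 1#) * ⟨ (λ _ → 0#) ,α q ⟩) q ≋
           dihedralRoot x (suc k) q p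
    tidy l = ℝ.trans
      (ℝ.+-congˡ (ℝ.+-congˡ (ℝ.*-congʳ (ℝ.+-congˡ (ℝ.-‿cong (ℝ.*-congˡ ⟨0,α⟩))))))
      (solve 6 (λ d u v two a b →
          con (+ 0) :+ (v :* a :+ (d :* v :- u :- two :* con (+ 0)) :* b) := (d :* v :- u) :* b :+ v :* a)
        ℝ.refl (x + x) u v (1# + 1#) (α p l) (α q l))

  -- Lengths and the signs of roots.

  module FiniteRoots (finite : Finite group) where
    open Length finite public

    ∙s-cancel-ℓ : ∀ {v p} → ℓ (v ∙ s p) ℕ.< ℓ v → ℓ v ≡ suc (ℓ (v ∙ s p))
    ∙s-cancel-ℓ {v} {p} vp<v = ℕ.≤-antisym
      (ℕ.≤-trans (ℓ-mono-≈ (sym (trans (∙-congˡ (identityʳ (s p))) (∙s∙s v p))))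
        (ℕ.≤-trans (ℓ-∙-eval (v ∙ s p) [ p ]) (ℕ.≤-reflexive (ℕ.+-comm _ 1))))
      vp<v

    module _ (v₀ : Carrier) (i : I) (v₀<v₀sᵢ : ℓ v₀ ℕ.< ℓ (v₀ ∙ s i))
      (IH : ∀ v j → ℓ v ℕ.< ℓ v₀ → ℓ v ℕ.< ℓ (v ∙ s j) → Pos (v · α j))
      where

      -- Alternating factors s p, s q are moved from v to x as long as this makes v
      -- shorter.  There are fewer than m p q of them, since otherwise the braid
      -- relation would shorten v₀ ∙ s i, so that x · α i is a nonnegative combination
      -- of α p and α q; in the end the induction hypothesis applies to v · α p and
      -- v · α q.
      strip : ∀ k n v x p q → Acc ℕ._<_ (ℓ v) → p ≢ q → m p q ≡ n → suc k ≤∞ n →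
              v₀ ≈ v ∙ x → x ∙ s i ≈ eval (alternating (suc k) p q) →
              x · α i ≋ dihedralRoot (cosine cosπ/ n) k p q →
              ℓ v₀ ≡ ℓ v ℕ.+ k → ℓ v ℕ.< ℓ (v ∙ s p) →
              0 ℕ.< k ⊎ ℓ (v ∙ s q) ℕ.< ℓ v →
              Pos (v₀ · α i)
      strip k n v x p q (acc rec) p≢q ≡.refl k<n v₀≈vx xsᵢ≈alt xα≋ ℓv₀≡ v<vp 0<k⊎vq<v
        with ℓ-∙s-<⊎> v q
      ... | inj₂ v<vq = Pos-≋
            (≋-sym (≋-trans (·-congʳ v₀≈vx (α i))
              (≋-trans (·-∙ v x (α i))
                (≋-trans (·-congˡ v xα≋)
                  (IsLinear.homo (·-isLinear v) _ (α p) _ (α q))))))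
            (Pos-lin (0≤U-cosine isCosπ/ n n≢1 k<n) (IH v p v<v₀ v<vp)
                     (0≤U-cosine isCosπ/ n n≢1 k≤n) (IH v q v<v₀ v<vq))
            where
            n≢1 = m-off-diagonal p≢q
            k≤n : k ≤∞ m p q
            k≤n = [ inj₁ , inj₂ ∘ ℕ.<⇒≤ ]′ k<n
            -- As `s q` lengthens `v`, the last hypothesis leaves only 0 < k: something has been
            -- stripped, and `IH` applies.
            v<v₀ : ℓ v ℕ.< ℓ v₀
            v<v₀ = ≡.subst (ℓ v ℕ.<_) (≡.sym ℓv₀≡)
              (ℕ.m<m+n (ℓ v) ([ (λ 0<k → 0<k) , (λ vq<v → contradiction vq<v (ℕ.<-asym v<vq)) ]′ 0<k⊎vq<v))
      ... | inj₁ vq<v =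
            strip (suc k) n (v ∙ s q) (s q ∙ x) q p (rec vq<v) (p≢q ∘ ≡.sym) (m-sym q p) k+1<n
              (trans v₀≈vx (sym v′x′≈vx))
              (trans (assoc _ _ _) (∙-congˡ xsᵢ≈alt))
              (≋-trans (·-∙ (s q) x (α i)) (≋-trans (·-congˡ (s q) xα≋)
                (≋-trans (·-s q _) (reflect-dihedralRoot k p q))))
              (≡.trans ℓv₀≡ (≡.trans (≡.cong (ℕ._+ k) ℓv≡) (≡.sym (ℕ.+-suc _ k))))
              (ℕ.<-≤-trans vq<v (ℓ-mono-≈ (sym (∙s∙s v q))))
              (inj₁ (ℕ.s≤s ℕ.z≤n))
            where
            ℓv≡ = ∙s-cancel-ℓ vq<v
            v′x′≈vx : ∀ {x} → (v ∙ s q) ∙ (s q ∙ x) ≈ v ∙ x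
            v′x′≈vx = trans (assoc _ _ _) (∙-congˡ (s∙s∙ q _))
            k+1≢n : suc k ≢ n
            k+1≢n k+1≡n = ℕ.<-irrefl ≡.refl (begin-strict
              ℓ v₀                                    <⟨ v₀<v₀sᵢ ⟩
              ℓ (v₀ ∙ s i)                            ≤⟨ ℓ-mono-≈ v₀sᵢ≈ ⟩
              ℓ ((v ∙ s q) ∙ eval (alternating k p q)) ≤⟨ ℓ-∙-eval (v ∙ s q) (alternating k p q) ⟩
              ℓ (v ∙ s q) ℕ.+ length (alternating k p q) ≡⟨ ≡.cong (ℓ (v ∙ s q) ℕ.+_) (length-alternating k p q) ⟩
              ℓ (v ∙ s q) ℕ.+ k                       <⟨ ℕ.+-monoˡ-< k vq<v ⟩
              ℓ v ℕ.+ k                               ≡⟨ ℓv₀≡ ⟨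
              ℓ v₀                                    ∎)
              where
              open ℕ.≤-Reasoning
              v₀sᵢ≈ : v₀ ∙ s i ≈ (v ∙ s q) ∙ eval (alternating k p q)
              v₀sᵢ≈ = trans (∙-congʳ v₀≈vx) (trans (assoc _ _ _) (trans (∙-congˡ (trans xsᵢ≈alt alt≈))
                (sym (assoc _ _ _))))
                where
                alt≈ : eval (alternating (suc k) p q) ≈ eval (alternating (suc k) q p)
                alt≈ = ≡.subst (λ l → eval (alternating l p q) ≈ eval (alternating l q p))
                  (≡.sym k+1≡n) (braid p q)
            k+1<n : suc (suc k) ≤∞ n
            k+1<n = [ inj₁ , (λ k<n → inj₂ (ℕ.≤∧≢⇒< k<n k+1≢n)) ]′ k<n

    -- Induction on the length of v. For a nonempty reduced word with last letter j, the generator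
    -- s_j shortens v, so j differs from i, and `strip` works in the dihedral group of i and j,
    -- starting with nothing moved.
    ascent⇒Pos : ∀ v i → ℓ v ℕ.< ℓ (v ∙ s i) → Pos (v · α i)
    ascent⇒Pos v i v<vsᵢ = go v i (<-wellFounded (ℓ v)) v<vsᵢ
      where
      go : ∀ v i → Acc ℕ._<_ (ℓ v) → ℓ v ℕ.< ℓ (v ∙ s i) → Pos (v · α i)
      go v i (acc rec) v<vsᵢ
        with reducedWord v | eval-reducedWord v | length-reducedWord v
      ... | is | is≈v | length≡ with initLast is
      ...   | []       = Pos-≋ (≋-sym (·-eval [] is≈v (α i))) (α-Pos i)
      ...   | js ∷ʳ′ j = strip v i v<vsᵢ (λ u j u<v → go u j (rec u<v))
              0 (m i j) v ε i j (<-wellFounded (ℓ v)) i≢j ≡.refl (0<∞ (m i j))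
              (sym (identityʳ v)) (trans (identityˡ _) (sym (identityʳ _)))
              (≋-trans (·-ε (α i)) (λ k → solve 2 (λ a b → a := con (+ 1) :* a :+ con (+ 0) :* b) ℝ.refl (α i k) (α j k)))
              (≡.sym (ℕ.+-identityʳ _)) v<vsᵢ (inj₂ vsⱼ<v)
              where
              js≈vsⱼ : eval js ≈ v ∙ s j
              js≈vsⱼ = trans (sym (∙s∙s (eval js) j)) (∙-congʳ
                (trans (trans (∙-congˡ (sym (identityʳ (s j)))) (sym (eval-++ js [ j ]))) is≈v))
              vsⱼ<v : ℓ (v ∙ s j) ℕ.< ℓ v
              vsⱼ<v = ℕ.≤-<-trans (ℓ-minimal js js≈vsⱼ) (ℕ.≤-reflexive
                (≡.trans (≡.trans (ℕ.+-comm 1 _) (≡.sym (List.length-++ js))) length≡))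
              i≢j : i ≢ j
              i≢j ≡.refl = ℕ.<-asym v<vsᵢ vsⱼ<v
              0<∞ : ∀ n → 1 ≤∞ n
              0<∞ zero    = inj₁ ≡.refl
              0<∞ (suc n) = inj₂ (ℕ.s≤s ℕ.z≤n)

    -- For `v ∙ s i` the generator `s i` is an ascent, and this element sends α_i to -vα_i.
    descent⇒Pos⁻ : ∀ v i → ℓ (v ∙ s i) ℕ.< ℓ v → Pos (⁻ (v · α i))
    descent⇒Pos⁻ v i vsᵢ<v = Pos-≋ -vα (ascent⇒Pos (v ∙ s i) i (ℕ.<-≤-trans vsᵢ<v (ℓ-mono-≈ (sym (∙s∙s v i)))))
      where
      -vα : (v ∙ s i) · α i ≋ ⁻ (v · α i)
      -vα = ≋-trans (·-∙ v (s i) (α i)) (≋-trans (·-congˡ v (·-s-α i)) (·-neg v (α i)))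

-- Signs of roots, the long element and reduced words.

module Toggles
  {c ℓ₁ ℓ₂ ℓ₃ w ℓ′ p : Level} (a : Level)
  (R : Reals c ℓ₁ ℓ₂ ℓ₃) (cosπ/ : ℕ → Reals.Carrier R)
  (isCosπ/ : Trigonometry.IsCosπ/-function R cosπ/)
  (C : CoxeterSystem w ℓ′) (finite : Finite (CoxeterSystem.group C))
  where

  open RootSystem R cosπ/ C
  open CoxeterSystem C hiding (_-_)
  open Roots R cosπ/ isCosπ/ C
  open FiniteRoots finite
  open OrderedField R
  open GroupProperties group using (⁻¹-anti-homo-∙; ε⁻¹≈ε; ∙-cancelʳ)
  private module ℝ = Reals R
  open ℝ using (0#; 1#; _+_; _*_; _-_; -_; _<_; _≤_) renaming (_≈_ to _≈ᴿ_; Carrier to ℝ)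
  open Sum (CommutativeRing.semiring ℝ.commutativeRing) using (sum)

  ⁻-cong : ∀ {β γ} → β ≋ γ → ⁻ β ≋ ⁻ γ
  ⁻-cong β≋γ k = ℝ.-‿cong (β≋γ k)

  ⁻-involutive : ∀ β → ⁻ ⁻ β ≋ β
  ⁻-involutive β k = solve 1 (λ x → :- (:- x) := x) ℝ.refl (β k)

  α∈Φ : ∀ i → α i ∈ Φ
  α∈Φ i = ε , i , ≋-sym (·-ε (α i))

  Φ-≋ : ∀ {β γ} → β ≋ γ → β ∈ Φ → γ ∈ Φ
  Φ-≋ β≋γ (v , i , β≋vα) = v , i , ≋-trans (≋-sym β≋γ) β≋vα

  ·-Φ : ∀ v {β} → β ∈ Φ → v · β ∈ Φ
  ·-Φ v (u , i , β≋uα) = v ∙ u , i , ≋-trans (·-congˡ v β≋uα) (≋-sym (·-∙ v u (α i)))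

  ⁻-Φ : ∀ {β} → β ∈ Φ → ⁻ β ∈ Φ
  ⁻-Φ (v , i , β≋vα) = v ∙ s i , i , ≋-sym (≋-trans (·-∙ v (s i) (α i))
    (≋-trans (·-congˡ v (·-s-α i)) (≋-trans (·-neg v (α i)) (⁻-cong (≋-sym β≋vα)))))

  -- The sign is read off from a comparison of lengths, so no order relation between reals has to be
  -- decided.
  Φ-Pos⊎Neg : ∀ {β} → β ∈ Φ → Pos β ⊎ Pos (⁻ β)
  Φ-Pos⊎Neg (v , i , β≋vα) with ℓ-∙s-<⊎> v i
  ... | inj₁ vsᵢ<v = inj₂ (Pos-≋ (⁻-cong (≋-sym β≋vα)) (descent⇒Pos⁻ v i vsᵢ<v))
  ... | inj₂ v<vsᵢ = inj₁ (Pos-≋ (≋-sym β≋vα) (ascent⇒Pos v i v<vsᵢ))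

  ·-0 : ∀ v {β} → (∀ k → β k ≈ᴿ 0#) → ∀ k → (v · β) k ≈ᴿ 0#
  ·-0 v {β} β≈0 k = ℝ.trans
    (·-congˡ v (λ k → ℝ.trans (β≈0 k) (solve 1 (λ b → con (+ 0) := con (+ 0) :* b :+ con (+ 0) :* b) ℝ.refl (β k))) k)
    (ℝ.trans (IsLinear.homo (·-isLinear v) 0# β 0# β k)
      (solve 1 (λ b → con (+ 0) :* b :+ con (+ 0) :* b := con (+ 0)) ℝ.refl ((v · β) k)))

  Φ-≉0 : ∀ {β} → β ∈ Φ → ¬ (∀ k → β k ≈ᴿ 0#)
  Φ-≉0 {β} (v , i , β≋vα) β≈0 = 0≉1 (begin
    0#                 ≈⟨ ·-0 (v ⁻¹) β≈0 i ⟨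
    (v ⁻¹ · β) i       ≈⟨ ·-congˡ (v ⁻¹) β≋vα i ⟩
    (v ⁻¹ · v · α i) i ≈⟨ ⁻¹-· v (α i) i ⟩
    α i i              ≡⟨ α-refl i ⟩
    1#                 ∎)
    where open SetoidReasoning (CommutativeRing.setoid ℝ.commutativeRing)

  Φ-¬Pos∧Neg : ∀ {β} → β ∈ Φ → Pos β → ¬ Pos (⁻ β)
  Φ-¬Pos∧Neg β∈Φ pos neg = Φ-≉0 β∈Φ λ k → 0≤-antisym (pos k) (neg k)

  -- The reflection changes only the coordinate i.
  reflect-Neg⇒multiple : ∀ i {δ} → Pos δ → Pos (⁻ reflect i δ) → δ ≋ λ k → δ i * α i k
  reflect-Neg⇒multiple i {δ} pos neg k with i Fin.≟ k
  ... | yes ≡.refl = ℝ.sym (ℝ.*-identityʳ (δ i))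
  ... | no i≢k = ℝ.trans (0≤-antisym (pos k) (≤-respʳ-≈ (ℝ.-‿cong rδ≈δ) (neg k))) (ℝ.sym (ℝ.zeroʳ (δ i)))
    where
    rδ≈δ : reflect i δ k ≈ᴿ δ k
    rδ≈δ = ℝ.trans (reflect-≋ i δ k) (ℝ.trans
      (ℝ.+-congˡ (ℝ.-‿cong (ℝ.*-congˡ (ℝ.reflexive (α-≢ i≢k)))))
      (solve 2 (λ x y → x :- y :* con (+ 0) := x) ℝ.refl (δ k) _))

  ·-scale : ∀ v x β → v · (λ k → x * β k) ≋ λ k → x * (v · β) k
  ·-scale v x β k = ℝ.trans
    (·-congˡ v (λ k → solve 2 (λ x b → x :* b := x :* b :+ con (+ 0) :* b) ℝ.refl x (β k)) k)
    (ℝ.trans (IsLinear.homo (·-isLinear v) x β 0# β k)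
      (solve 2 (λ x b → x :* b :+ con (+ 0) :* b := x :* b) ℝ.refl x ((v · β) k)))

  ·-reflect : ∀ v i δ → v · reflect i δ ≋ lin 1# (v · δ) (- ((1# + 1#) * ⟨ δ ,α i ⟩)) (v · α i)
  ·-reflect v i δ = ≋-trans
    (·-congˡ v λ k → ℝ.trans (reflect-≋ i δ k)
      (solve 3 (λ x t a → x :- t :* a := con (+ 1) :* x :+ (:- t) :* a) ℝ.refl (δ k) _ (α i k)))
    (IsLinear.homo (·-isLinear v) 1# δ _ (α i))

  ·-Pos⁻ : ∀ v → (∀ j → Pos (⁻ (v · α j))) → ∀ {δ} → Pos δ → Pos (⁻ (v · δ))
  ·-Pos⁻ v neg {δ} pos k = ≤-respʳ-≈
    (ℝ.-‿cong (ℝ.sym (linear-expansion (·-isLinear v) δ k)))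
    (0≤-sum λ j → ≤-respʳ-≈
      (solve 2 (λ x y → x :* (:- y) := :- (x :* y)) ℝ.refl (δ j) ((v · α j) k))
      (0≤-* (pos j) (neg j k)))
    where
    0≤-sum : ∀ {n} {x : Fin n → ℝ} → (∀ j → 0# ≤ - x j) → 0# ≤ - sum x
    0≤-sum {zero}      _   = ≈0⇒0≤ (solve 0 (:- con (+ 0) := con (+ 0)) ℝ.refl)
    0≤-sum {suc n} {x} 0≤- = ≤-respʳ-≈
      (solve 2 (λ y z → :- y :+ :- z := :- (y :+ z)) ℝ.refl (x zero) (sum (x ∘ suc)))
      (0≤-+ (0≤- zero) (0≤-sum (0≤- ∘ suc)))

  -- Inversion preserves length, so `v ⁻¹` has maximal length too and every generator is a descent
  -- for it.
  long⇒Pos⁻ : ∀ {w₀} → IsLongElement w₀ → ∀ {v} → v ≈ w₀ → ∀ j → Pos (⁻ (v ⁻¹ · α j))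
  long⇒Pos⁻ {w₀} (N , w₀-length , maximal) {v} v≈w₀ j with ℓ-∙s-<⊎> (v ⁻¹) j
  ... | inj₁ descent = descent⇒Pos⁻ (v ⁻¹) j descent
  ... | inj₂ ascent  = contradiction
    (maximal (v ⁻¹ ∙ s j) (ℓ (v ⁻¹ ∙ s j)) (proj₂ (hasLength (v ⁻¹ ∙ s j))))
    (ℕ.<⇒≱ (≡.subst (ℕ._< ℓ (v ⁻¹ ∙ s j))
      (≡.trans (ℓ-⁻¹ v) (≡.trans (ℓ-cong v≈w₀) (ℓ-unique w₀-length))) ascent))

  [s∙]⁻¹-· : ∀ i v β → (s i ∙ v) ⁻¹ · β ≋ v ⁻¹ · reflect i β
  [s∙]⁻¹-· i v β = ≋-trans
    (·-congʳ (trans (⁻¹-anti-homo-∙ (s i) v) (∙-congˡ (s⁻¹ i))) β)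
    (≋-trans (·-∙ (v ⁻¹) (s i) β) (·-congˡ (v ⁻¹) (·-s i β)))

  IsReduced : List I → Set
  IsReduced is = ℓ (eval is) ≡ length is

  module _ {i : I} {is : List I} (reduced : IsReduced (i ∷ is)) where

    tail-reduced : IsReduced is
    tail-reduced = ℕ.≤-antisym (ℓ-minimal is refl) (ℕ.s≤s⁻¹ (ℕ.≤-trans (ℕ.≤-reflexive (≡.sym reduced))
      (ℕ.≤-trans (ℓ-minimal (i ∷ reducedWord (eval is)) (∙-congˡ (eval-reducedWord (eval is))))
        (ℕ.≤-reflexive (≡.cong suc (length-reducedWord (eval is)))))))

    -- The inverse of the longer word is `eval is ⁻¹ ∙ s i`, so reducedness makes `s i` an ascent
    -- for `eval is ⁻¹`.
    head-Pos : Pos (eval is ⁻¹ · α i)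
    head-Pos = ascent⇒Pos (eval is ⁻¹) i (ℕ.≤-reflexive (≡.trans
      (≡.cong suc (≡.trans (ℓ-⁻¹ (eval is)) tail-reduced))
      (≡.trans (≡.sym reduced) (≡.trans (≡.sym (ℓ-⁻¹ (s i ∙ eval is)))
        (ℓ-cong (trans (⁻¹-anti-homo-∙ (s i) (eval is)) (∙-congˡ (s⁻¹ i))))))))

  -- Convex sets and the roots nonnegative on them.

  module _ {L : Pred Carrier p} (x₀ : Satisfiable L) (convex : Convex a L) where

    Rts-intro : ∀ {β} → β ∈ Φ → (∀ {v} → v ∈ L → Pos (v · β)) → β ∈ Rts L
    Rts-intro β∈Φ pos = β∈Φ , λ {v} v∈L → ·-Φ v β∈Φ , pos v∈L

    Rts-Pos : ∀ {β} → β ∈ Rts L → ∀ {v} → v ∈ L → Pos (v · β)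
    Rts-Pos (_ , L⊆H) v∈L = proj₂ (L⊆H v∈L)

    Rts-≋ : ∀ {β γ} → β ≋ γ → β ∈ Rts L → γ ∈ Rts L
    Rts-≋ β≋γ β∈R = Rts-intro (Φ-≋ β≋γ (proj₁ β∈R)) λ {v} v∈L → Pos-≋ (·-congˡ v β≋γ) (Rts-Pos β∈R v∈L)

    -- For a root, membership amounts to inequalities `≤`, which are negations and hence stable
    -- under double negation.
    Rts-stable : ∀ {β} → β ∈ Φ → ¬ (β ∉ Rts L) → β ∈ Rts L
    Rts-stable β∈Φ ¬β∉R = Rts-intro β∈Φ λ v∈L k β<0 → ¬β∉R λ β∈R → Rts-Pos β∈R v∈L k β<0

    -- The factor x cannot vanish, because the root β would vanish with it; so a negative coordinate
    -- of vγ contradicts the positivity of vβ.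
    Rts-scale : ∀ {β γ x} → γ ∈ Φ → 0# ≤ x → (β ≋ λ k → x * γ k) → β ∈ Rts L → γ ∈ Rts L
    Rts-scale {β} {γ} {x} γ∈Φ 0≤x β≋xγ β∈R = Rts-intro γ∈Φ λ {v} v∈L k vγ<0 →
      Φ-≉0 (proj₁ β∈R) λ l → ℝ.trans (β≋xγ l)
        (ℝ.trans (ℝ.*-congʳ (≮∧≯⇒≈0 0≤x (x≯0 v∈L k vγ<0))) (ℝ.zeroˡ (γ l)))
      where
      x≯0 : ∀ {v} → v ∈ L → ∀ k → (v · γ) k < 0# → ¬ (0# < x)
      x≯0 {v} v∈L k vγ<0 0<x = 0≤-cancelˡ-* 0<x
        (≤-respʳ-≈ (ℝ.trans (·-congˡ v β≋xγ k) (·-scale v x γ k)) (Rts-Pos β∈R v∈L k)) vγ<0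

    Rts-lin : ∀ {a β b γ} → 0# ≤ a → β ∈ Rts L → 0# ≤ b → γ ∈ Rts L →
              lin a β b γ ∈ Φ → lin a β b γ ∈ Rts L
    Rts-lin {a} {β} {b} {γ} 0≤a β∈R 0≤b γ∈R lin∈Φ = Rts-intro lin∈Φ λ {v} v∈L →
      Pos-≋ (≋-sym (IsLinear.homo (·-isLinear v) a β b γ))
        (Pos-lin 0≤a (Rts-Pos β∈R v∈L) 0≤b (Rts-Pos γ∈R v∈L))

    -- The roots of the half-spaces that cut out `L` all lie in `Rts L`. This is where convexity
    -- enters.
    ∈L-intro : ∀ {v} → (∀ {β} → β ∈ Rts L → Pos (v · β)) → v ∈ L
    ∈L-intro {v} pos = let A , β , β∈Φ , L⊆⋂ , ⋂⊆L = convex in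
      ⋂⊆L λ x → ·-Φ v (β∈Φ x) , pos (β∈Φ x , λ u∈L → L⊆⋂ u∈L x)

    ∈L-resp-≈ : ∀ {u v} → u ≈ v → u ∈ L → v ∈ L
    ∈L-resp-≈ u≈v u∈L = ∈L-intro λ {β} β∈R → Pos-≋ (·-congʳ u≈v β) (Rts-Pos β∈R u∈L)

    -- If β in `Rts L` turned negative, then s_i would make the positive root uβ negative. So uβ
    -- would be a multiple of α_i, and u⁻¹α_i would lie in `Rts L` along with β.
    s∙-∈L : ∀ i {u} → u ∈ L → u ⁻¹ · α i ∉ Rts L → s i ∙ u ∈ L
    s∙-∈L i {u} u∈L γ∉R = ∈L-intro λ {β} β∈R → positive β∈R
      where
      positive : ∀ {β} → β ∈ Rts L → Pos ((s i ∙ u) · β)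
      positive {β} β∈R with Φ-Pos⊎Neg (·-Φ (s i ∙ u) (proj₁ β∈R))
      ... | inj₁ pos = pos
      ... | inj₂ neg = contradiction
        (Rts-scale (·-Φ (u ⁻¹) (α∈Φ i)) (uβ-pos i) β≋ β∈R) γ∉R
        where
        uβ-pos = Rts-Pos β∈R u∈L
        rδ≋ : (s i ∙ u) · β ≋ reflect i (u · β)
        rδ≋ = ≋-trans (·-∙ (s i) u β) (·-s i (u · β))
        β≋ : β ≋ λ k → (u · β) i * (u ⁻¹ · α i) k
        β≋ = ≋-trans (≋-sym (⁻¹-· u β)) (≋-trans
          (·-congˡ (u ⁻¹) (reflect-Neg⇒multiple i uβ-pos (Pos-≋ (⁻-cong rδ≋) neg)))
          (·-scale (u ⁻¹) ((u · β) i) (α i)))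

    -- Toggles restricted to `L`.

    module _ (τ : I → Carrier → Carrier) (isToggle : ∀ i → IsToggle L i (τ i)) where

      -- Equality in the finite group is decidable and `s i ∙ u` differs from `u`, so the value of
      -- the toggle reveals which clause applies.
      toggle-cases : ∀ i u → (u ⁻¹ · α i ∈ Rts L × τ i u ≈ u)
                           ⊎ (u ⁻¹ · α i ∉ Rts L × τ i u ≈ s i ∙ u)
      toggle-cases i u with τ i u ≈? u
      ... | no  τu≉u = let γ∉R = λ γ∈R → τu≉u (proj₁ (isToggle i u) γ∈R) in
                       inj₂ (γ∉R , proj₂ (isToggle i u) γ∉R)
      ... | yes τu≈u = inj₁ (Rts-stable (·-Φ (u ⁻¹) (α∈Φ i)) ¬γ∉R , τu≈u)
        where
        ¬γ∉R : ¬ (u ⁻¹ · α i ∉ Rts L)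
        ¬γ∉R γ∉R = s≉ε i (∙-cancelʳ u (s i) ε
          (trans (sym (proj₂ (isToggle i u) γ∉R)) (trans τu≈u (sym (identityˡ u)))))

      τ-cong : ∀ i {u v} → u ≈ v → τ i u ≈ τ i v
      τ-cong i {u} {v} u≈v with toggle-cases i u | toggle-cases i v
      ... | inj₁ (_ , τu≈)   | inj₁ (_ , τv≈)   = trans τu≈ (trans u≈v (sym τv≈))
      ... | inj₂ (_ , τu≈)   | inj₂ (_ , τv≈)   = trans τu≈ (trans (∙-congˡ u≈v) (sym τv≈))
      ... | inj₁ (γ∈R , _)   | inj₂ (γ∉R , _)   = contradiction (Rts-≋ (·-congʳ (⁻¹-cong u≈v) (α i)) γ∈R) γ∉R
      ... | inj₂ (γ∉R , _)   | inj₁ (γ∈R , _)   = contradiction (Rts-≋ (·-congʳ (⁻¹-cong (sym u≈v)) (α i)) γ∈R) γ∉R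

      τ-∈L : ∀ i {u} → u ∈ L → τ i u ∈ L
      τ-∈L i {u} u∈L with toggle-cases i u
      ... | inj₁ (_ , τu≈u)    = ∈L-resp-≈ (sym τu≈u) u∈L
      ... | inj₂ (γ∉R , τu≈su) = ∈L-resp-≈ (sym τu≈su) (s∙-∈L i u∈L γ∉R)

      τ-involutive : ∀ i {u} → u ∈ L → τ i (τ i u) ≈ u
      τ-involutive i {u} u∈L with toggle-cases i u
      ... | inj₁ (_ , τu≈u)    = trans (τ-cong i τu≈u) τu≈u
      ... | inj₂ (γ∉R , τu≈su) with toggle-cases i (s i ∙ u)
      ...   | inj₂ (_ , τsu≈)  = trans (τ-cong i τu≈su) (trans τsu≈ (s∙s∙ i u))
      -- Here (s_i u)⁻¹α_i = -u⁻¹α_i takes the value -α_i at the point u of `L`, so it is not in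
      -- `Rts L`.
      ...   | inj₁ (γ∈R , _)   = contradiction (Pos-≋ u·≋ (Rts-Pos γ∈R u∈L)) (Φ-¬Pos∧Neg (α∈Φ i) (α-Pos i))
        where
        u·≋ : u · (s i ∙ u) ⁻¹ · α i ≋ ⁻ α i
        u·≋ = ≋-trans (·-congˡ u ([s∙]⁻¹-· i u (α i)))
          (≋-trans (·-⁻¹ u (reflect i (α i))) (reflect-negates-α i))

      L⊆ToggleImage : ∀ is → L ⊆ ToggleImage τ is
      L⊆ToggleImage []       {v} _   = v , refl
      L⊆ToggleImage (i ∷ is) {v} v∈L with L⊆ToggleImage is (τ-∈L i v∈L)
      ... | u , e = u , trans (τ-cong i e) (τ-involutive i v∈L)

      -- The property of the pair (v , u) preserved along a reduced word.

      NoSeparation : Carrier → Carrier → Set (c ⊔ ℓ₁ ⊔ ℓ₃ ⊔ w ⊔ p)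
      NoSeparation v u = ∀ {δ} → δ ∈ Φ → Pos δ → Pos (⁻ (v ⁻¹ · δ)) → ⁻ (u ⁻¹ · δ) ∉ Rts L

      noSeparation-ε : ∀ u → NoSeparation ε u
      noSeparation-ε u δ∈Φ pos neg _ = Φ-¬Pos∧Neg δ∈Φ pos
        (Pos-≋ (⁻-cong (≋-trans (·-congʳ ε⁻¹≈ε _) (·-ε _))) neg)

      noSeparation-τ : ∀ i v u → Pos (v ⁻¹ · α i) → NoSeparation v u → NoSeparation (s i ∙ v) (τ i u)
      noSeparation-τ i v u vα-pos IH {δ} δ∈Φ pos neg h = by-cases (Φ-Pos⊎Neg δ′∈Φ) (toggle-cases i u)
        where
        δ′ = reflect i δ

        δ′∈Φ : δ′ ∈ Φ
        δ′∈Φ = Φ-≋ (·-s i δ) (·-Φ (s i) δ∈Φ)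

        vδ′-neg : Pos (⁻ (v ⁻¹ · δ′))
        vδ′-neg = Pos-≋ (⁻-cong ([s∙]⁻¹-· i v δ)) neg

        h-at : ∀ {x} → τ i u ≈ x → ⁻ (x ⁻¹ · δ) ∈ Rts L
        h-at τu≈x = Rts-≋ (⁻-cong (·-congʳ (⁻¹-cong τu≈x) δ)) h

        t = (1# + 1#) * ⟨ δ ,α i ⟩

        module _ (δ′-pos : Pos δ′) (γ∈R : u ⁻¹ · α i ∈ Rts L) (τu≈u : τ i u ≈ u) where

          t≱0 : ¬ (0# ≤ t)
          t≱0 0≤t = IH δ′∈Φ δ′-pos vδ′-neg
            (Rts-≋ (≋-sym ≋lin) (Rts-lin (0<⇒0≤ 0<1) (h-at τu≈u) 0≤t γ∈R
              (Φ-≋ ≋lin (⁻-Φ (·-Φ (u ⁻¹) δ′∈Φ)))))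
            where
            ≋lin : ⁻ (u ⁻¹ · δ′) ≋ lin 1# (⁻ (u ⁻¹ · δ)) t (u ⁻¹ · α i)
            ≋lin k = ℝ.trans (⁻-cong (·-reflect (u ⁻¹) i δ) k)
              (solve 3 (λ x t a → :- (con (+ 1) :* x :+ (:- t) :* a) := con (+ 1) :* (:- x) :+ t :* a)
                ℝ.refl ((u ⁻¹ · δ) k) t ((u ⁻¹ · α i) k))

          -t≱0 : ¬ (0# ≤ - t)
          -t≱0 0≤-t = IH δ∈Φ pos (Pos-≋ lin≋ (Pos-lin (0<⇒0≤ 0<1) vδ′-neg 0≤-t vα-pos)) (h-at τu≈u)
            where
            lin≋ : lin 1# (⁻ (v ⁻¹ · δ′)) (- t) (v ⁻¹ · α i) ≋ ⁻ (v ⁻¹ · δ)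
            lin≋ k = ℝ.trans (ℝ.+-congʳ (ℝ.*-congˡ (⁻-cong (·-reflect (v ⁻¹) i δ) k)))
              (solve 3 (λ x t a → con (+ 1) :* (:- (con (+ 1) :* x :+ (:- t) :* a)) :+ (:- t) :* a := :- x)
                ℝ.refl ((v ⁻¹ · δ) k) t ((v ⁻¹ · α i) k))

        module _ (δ′-neg : Pos (⁻ δ′)) where

          ·δ≋ : ∀ v → v · δ ≋ λ k → δ i * (v · α i) k
          ·δ≋ v = ≋-trans (·-congˡ v (reflect-Neg⇒multiple i pos δ′-neg)) (·-scale v (δ i) (α i))

          -- Since δ is a multiple of α_i, the root -(s_i u)⁻¹δ is a nonnegative multiple of u⁻¹α_i;
          -- its membership in `Rts L` would force that of u⁻¹α_i.
          moved : u ⁻¹ · α i ∉ Rts L → ¬ (τ i u ≈ s i ∙ u)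
          moved γ∉R τu≈su = γ∉R (Rts-scale (·-Φ (u ⁻¹) (α∈Φ i)) (pos i) ≋scaled (h-at τu≈su))
            where
            ≋scaled : ⁻ ((s i ∙ u) ⁻¹ · δ) ≋ λ k → δ i * (u ⁻¹ · α i) k
            ≋scaled k = ℝ.trans
              (⁻-cong (≋-trans (·δ≋ ((s i ∙ u) ⁻¹)) (λ k → ℝ.*-congˡ (su⁻¹α k))) k)
              (solve 2 (λ x y → :- (x :* (:- y)) := x :* y) ℝ.refl (δ i) ((u ⁻¹ · α i) k))
              where
              su⁻¹α : (s i ∙ u) ⁻¹ · α i ≋ ⁻ (u ⁻¹ · α i)
              su⁻¹α = ≋-trans ([s∙]⁻¹-· i u (α i))
                (≋-trans (·-congˡ (u ⁻¹) (reflect-negates-α i)) (·-neg (u ⁻¹) (α i)))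

          -- Now -u⁻¹δ is a nonpositive multiple of γ = u⁻¹α_i. Both cannot lie in `Rts L`, as the
          -- point x of the nonempty set `L` shows.
          stayed : u ⁻¹ · α i ∈ Rts L → ¬ (τ i u ≈ u)
          stayed γ∈R τu≈u = Φ-¬Pos∧Neg (·-Φ x (proj₁ β∈R)) (Rts-Pos β∈R x∈L)
            (Pos-≋ (≋-sym ⁻xβ≋) λ k → 0≤-* (pos i) (Rts-Pos γ∈R x∈L k))
            where
            x   = proj₁ x₀
            x∈L = proj₂ x₀
            β   = ⁻ (u ⁻¹ · δ)
            β∈R = h-at τu≈u
            ⁻xβ≋ : ⁻ (x · β) ≋ λ k → δ i * (x · u ⁻¹ · α i) k
            ⁻xβ≋ = ≋-trans (⁻-cong (·-neg x (u ⁻¹ · δ))) (≋-trans (⁻-involutive (x · u ⁻¹ · δ))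
              (≋-trans (·-congˡ x (·δ≋ (u ⁻¹))) (·-scale x (δ i) (u ⁻¹ · α i))))

        by-cases : Pos δ′ ⊎ Pos (⁻ δ′) →
                   (u ⁻¹ · α i ∈ Rts L × τ i u ≈ u) ⊎ (u ⁻¹ · α i ∉ Rts L × τ i u ≈ s i ∙ u) → ⊥
        by-cases (inj₁ δ′-pos) (inj₂ (γ∉R , τu≈su)) = IH δ′∈Φ δ′-pos vδ′-neg
          (Rts-≋ (⁻-cong ([s∙]⁻¹-· i u δ)) (h-at τu≈su))
        by-cases (inj₁ δ′-pos) (inj₁ (γ∈R , τu≈u)) =
          -- The goal is empty, so the sign of t need not be decided: `t≱0` may assume t < 0 in
          -- order to refute it, and t < 0 falls under `-t≱0`.
          t≱0 δ′-pos γ∈R τu≈u λ t<0 → -t≱0 δ′-pos γ∈R τu≈u (0<⇒0≤ (<0⇒0<- t<0))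
        by-cases (inj₂ δ′-neg) (inj₁ (γ∈R , τu≈u))  = stayed δ′-neg γ∈R τu≈u
        by-cases (inj₂ δ′-neg) (inj₂ (γ∉R , τu≈su)) = moved δ′-neg γ∉R τu≈su

      noSeparation-foldr : ∀ is → IsReduced is → ∀ u → NoSeparation (eval is) (foldr τ u is)
      noSeparation-foldr []       _       u = noSeparation-ε u
      noSeparation-foldr (i ∷ is) reduced u = noSeparation-τ i (eval is) (foldr τ u is)
        (head-Pos {i} {is} reduced) (noSeparation-foldr is (tail-reduced {i} {is} reduced) u)

      ToggleImage⊆L : ∀ {w₀} → IsLongElement w₀ → ∀ is → IsReducedWordFor is w₀ → ToggleImage τ is ⊆ L
      ToggleImage⊆L long is (is≈w₀ , is-length) {v} (u , e) = ∈L-resp-≈ e (∈L-intro positive)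
        where
        u′ = foldr τ u is
        reduced : IsReduced is
        reduced = ≡.trans (ℓ-cong is≈w₀) (ℓ-unique is-length)
        positive : ∀ {β} → β ∈ Rts L → Pos (u′ · β)
        positive {β} β∈R with Φ-Pos⊎Neg (·-Φ u′ (proj₁ β∈R))
        ... | inj₁ u′β-pos = u′β-pos
        -- The invariant is applied to δ = -u′β, which is positive and is made negative by the
        -- inverse of the long element; then -u′⁻¹δ is β itself.
        ... | inj₂ u′β-neg = contradiction (Rts-≋ (≋-sym ⁻u′⁻¹≋) β∈R)
          (noSeparation-foldr is reduced u (⁻-Φ (·-Φ u′ (proj₁ β∈R))) u′β-neg
            (·-Pos⁻ (eval is ⁻¹) (long⇒Pos⁻ long is≈w₀) u′β-neg))
          where
          ⁻u′⁻¹≋ : ⁻ (u′ ⁻¹ · ⁻ (u′ · β)) ≋ β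
          ⁻u′⁻¹≋ = ≋-trans (⁻-cong (·-neg (u′ ⁻¹) (u′ · β)))
            (≋-trans (⁻-involutive (u′ ⁻¹ · u′ · β)) (⁻¹-· u′ β))

theorem1p22 :
    ∀ {c ℓ₁ ℓ₂ ℓ₃ w ℓ p} a
    (R : Reals c ℓ₁ ℓ₂ ℓ₃)
    (cosπ/ : ℕ → Reals.Carrier R) → Trigonometry.IsCosπ/-function R cosπ/ →
    (C : CoxeterSystem w ℓ) →
    let open CoxeterSystem C
        open RootSystem R cosπ/ C
    in
    Finite group →
    (w₀ : Carrier) → IsLongElement w₀ →
    (is : List I) → IsReducedWordFor is w₀ →
    (L : Pred Carrier p) → Satisfiable L → Convex a L →
    (τ : I → Carrier → Carrier) → (∀ i → IsToggle L i (τ i)) →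
    ToggleImage τ is ≐ L
theorem1p22 a R cosπ/ isCosπ/ C finite w₀ long is reduced L x₀ convex τ isToggle =
  ToggleImage⊆L x₀ convex τ isToggle long is reduced , L⊆ToggleImage x₀ convex τ isToggle is
  where open Toggles a R cosπ/ isCosπ/ C finite
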